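{- Let $P$ be an abstract proof system, let $t=(p_{\mathrm{fml}},\mathrm{prog})$ be a trace structure for $P$, and let $c$ be a pre-proof of $P$. Then $c$ satisfies the global trace condition on $t$ if and only if, for every ordinal $\gamma$, the $F[P^\gamma]$-coalgebra $\mathrm{Coalg}((u^\gamma)^*)(c)$ is recursive.
   Context: Presheaves and polynomials. For a small category $\mathbb{A}$, $\widehat{\mathbb{A}}=\mathbf{Set}^{\mathbb{A}^{\mathrm{op}}}$. For a functor $f\colon\mathbb{I}\to\mathbb{J}$ of small categories, $f^*=(-)\circ f^{\mathrm{op}}\colon\widehat{\mathbb{J}}\to\widehat{\mathbb{I}}$, with left adjoint $f_!$ and right adjoint $f_*$. A discrete fibration is a functor $t\colon\mathbb{E}\to\mathbb{B}$ such that each $b\to t(e)$ has a unique lift $e'\to e$. A two-sided discrete fibration is a pair $(s\colon\mathbb{I}\to\mathbb{A},q\colon\mathbb{I}\to\mathbb{B})$ such that: each $a\to s(i)$ has a unique lift $i'\to i$ which $q$ sends to $\mathrm{id}_{q(i)}$; each $q(i)\to b$ has a unique lift $i\to i'$ which $s$ sends to $\mathrm{id}_{s(i)}$; and for each $f\colon i\to j$ the domain of the lift of $s(f)$ equals the codomain of the lift of $q(f)$ and the composite of these lifts is $f$. A polynomial $(s,q,t)$ is a diagram of small categories $\mathbb{A}\xleftarrow{s}\mathbb{I}\xrightarrow{q}\mathbb{J}\xrightarrow{t}\mathbb{A}$ with $(s,q)$ a two-sided discrete fibration and $t$ a discrete fibration. Its familial functor is $F[P]=t_!q_*s^*\colon\widehat{\mathbb{A}}\to\widehat{\mathbb{A}}$;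 concretely $F[P](G)(a)\cong\coprod_{j\in\mathbb{J}_a}\lim_{i\in\mathbb{I}_j^{\mathrm{op}}}G(s(i))$, where $\mathbb{J}_a$ is the fibre of $t$ over $a$ and $\mathbb{I}_j$ the fibre of $q$ over $j$. A morphism of polynomials $(s',q',t')\to(s,q,t)$ (category $\mathbf{VPoly}$) is a triple of functors $u\colon\mathbb{A}'\to\mathbb{A}$, $u_1\colon\mathbb{I}'\to\mathbb{I}$, $u_2\colon\mathbb{J}'\to\mathbb{J}$ with $us'=su_1$, $u_2q'=qu_1$, $ut'=tu_2$, the last square being a pullback. It induces a canonical natural transformation $\tau\colon u^*F[P]\Rightarrow F[P']u^*$, $\tau_{X,a'}(j,\langle n_i\rangle_{i\in\mathbb{I}_j})=(j',\langle n_{u_1(i')}\rangle_{i'\in\mathbb{I}'_{j'}})$, where $j'$ is the unique object with $t'(j')=a'$, $u_2(j')=j$. Put $\mathrm{Coalg}(u^*)(c)=\tau_C\circ u^*(c)$ for an $F[P]$-coalgebra $c\colon C\to F[P]C$. A coalgebra $c\colon C\to FC$ is recursive if for every algebra $a\colon FA\to A$ there is a unique $h\colon C\to A$ with $h=a\circ Fh\circ c$. Proof systems. For $\mathrm{ar}\colon R\to\mathbf{Cat}$ ($\mathbf{Cat}$: small categories), $q_{\mathrm{ar}}\colon\int\mathrm{ar}\to R$ is the Grothendieck opfibration: objects are pairs $(r,i)$ with $i\in\mathrm{ar}(r)$ (also written $i\in\mathrm{ar}(r)$), morphisms $(r,i)\to(r',i')$ are pairs of $h\colon r\to r'$ and $\mathrm{ar}(h)(i)\to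 i'$. For a presheaf $X$ on a category, $p_X\colon\int X\to\cdot$ denotes its category of elements with projection. An abstract proof system $P=(\mathrm{prem},q_{\mathrm{ar}},\mathrm{ccl})$ consists of small categories $\mathrm{Jdg},R$ and functors $\mathrm{ar}\colon R\to\mathbf{Cat}$, $\mathrm{prem}\colon\int\mathrm{ar}\to\mathrm{Jdg}$, $\mathrm{ccl}\colon R\to\mathrm{Jdg}$ such that $\mathrm{Jdg}\xleftarrow{\mathrm{prem}}\int\mathrm{ar}\xrightarrow{q_{\mathrm{ar}}}R\xrightarrow{\mathrm{ccl}}\mathrm{Jdg}$ is a polynomial; it is used that $\mathrm{prem}(r_1,i)=\mathrm{prem}(r_2,\mathrm{ar}(h)(i))$ for $h\colon r_1\to r_2$. A pre-proof of $P$ is a coalgebra $c\colon C\to F[P](C)$. Its labelled graph has nodes $(s,n)$ with $n\in C(s)$, and, when $c_s(n)=(r,\langle n_i\rangle_{i\in\mathrm{ar}(r)^{\mathrm{op}}})$, an edge from $n\in C(s)$ to $n_i\in C(\mathrm{prem}(r,i))$ labelled $i\in\mathrm{ar}(r)$ for each $i\in\mathrm{ar}(r)$. Trace structures. A trace structure for $P$ consists of: a presheaf $\mathrm{fml}\in\widehat{\mathrm{Jdg}}$; a proof system $T=(\int\mathrm{fml}\xleftarrow{\mathrm{prem}'}\int\mathrm{ar}'\xrightarrow{q_{\mathrm{ar}'}}R'\xrightarrow{\mathrm{ccl}'}\int\mathrm{fml})$ and a morphism $T\to P$ in $\mathbf{VPoly}$ whose component on judgements is the projection $p_{\mathrm{fml}}\colon\int\mathrm{fml}\to\mathrm{Jdg}$;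 and a set $\mathrm{prog}$ as follows. For $i\in\mathrm{ar}(r)$, $\varphi\in\mathrm{fml}(\mathrm{ccl}(r))$, $\psi\in\mathrm{fml}(\mathrm{prem}(r,i))$ write $\varphi\stackrel{i\in\mathrm{ar}(r)}{\rightsquigarrow}\psi$ if there is $i'\in\int\mathrm{ar}'$ with $(p_{\mathrm{fml}})_1(i')=(r,i)$, $\mathrm{prem}'(i')=\psi$ and $\mathrm{ccl}'(q_{\mathrm{ar}'}(i'))=\varphi$. Then $\mathrm{prog}$ is a subset of the set of all such steps $\varphi\stackrel{i\in\mathrm{ar}(r)}{\rightsquigarrow}\psi$ (ranging over all $(r,i)\in\int\mathrm{ar}$; elements are called progressing), and it is required that for each $h\colon r_1\to r_2$ in $R$ and $i\in\mathrm{ar}(r_1)$, $\varphi\stackrel{\mathrm{ar}(h)(i)\in\mathrm{ar}(r_2)}{\rightsquigarrow}\psi$ (resp. and it is in $\mathrm{prog}$) implies $\mathrm{fml}(\mathrm{ccl}(h))(\varphi)\stackrel{i\in\mathrm{ar}(r_1)}{\rightsquigarrow}\psi$ (resp. and it is in $\mathrm{prog}$). A trace along an infinite path $\langle n_k\in C(s_k)\rangle_{k\in\mathbb{N}}$ with labels $\langle j_k\in\mathrm{ar}(r_k)\rangle_{k\in\mathbb{N}}$ in the labelled graph of $c$ is a sequence $\varphi_k\in\mathrm{fml}(s_k)$ with $\varphi_k\stackrel{j_k\in\mathrm{ar}(r_k)}{\rightsquigarrow}\varphi_{k+1}$ for all $k$; it is infinitely progressing if infinitely many of these steps are in $\mathrm{prog}$.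 The pre-proof $c$ satisfies the global trace condition (GTC) on the trace structure if for every infinite path in the labelled graph of $c$ there is an infinitely progressing trace along some suffix of it. Ordinal annotation. Identify $\gamma$ with $\{\alpha\mid\alpha<\gamma\}$. $\mathrm{Jdg}^\gamma$ has objects $(s,f)$ with $s\in\mathrm{Jdg}$ and $f\colon\mathrm{fml}(s)\to\gamma$ a function; a morphism $(s_1,f_1)\to(s_2,f_2)$ is $h\colon s_1\to s_2$ with $f_1(\mathrm{fml}(h)(\varphi))\le f_2(\varphi)$ for all $\varphi\in\mathrm{fml}(s_2)$. $R^\gamma$ has objects $(r,f)$ with $r\in R$, $f\colon\mathrm{fml}(\mathrm{ccl}(r))\to\gamma$; morphisms $(r_1,f_1)\to(r_2,f_2)$ are $h\colon r_1\to r_2$ such that $\mathrm{ccl}(h)\colon(\mathrm{ccl}(r_1),f_1)\to(\mathrm{ccl}(r_2),f_2)$ is in $\mathrm{Jdg}^\gamma$. $\mathrm{ar}^\gamma(r,f)$ has objects $(i,g)$ with $i\in\mathrm{ar}(r)$, $g\colon\mathrm{fml}(\mathrm{prem}(r,i))\to\gamma$ such that for every $\varphi\stackrel{i\in\mathrm{ar}(r)}{\rightsquigarrow}\psi$ one has $g(\psi)\le f(\varphi)$, with $g(\psi)<f(\varphi)$ if this step is in $\mathrm{prog}$; morphisms $(i_1,g_1)\to(i_2,g_2)$ are $h\colon i_1\to i_2$ in $\mathrm{ar}(r)$ such that $\mathrm{prem}(r,h)$ is a morphism $(\mathrm{prem}(r,i_1),g_1)\to(\mathrm{prem}(r,i_2),g_2)$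 in $\mathrm{Jdg}^\gamma$; and $\mathrm{ar}^\gamma(h)(i,g)=(\mathrm{ar}(h)(i),g)$, acting on morphisms as $\mathrm{ar}(h)$. Let $\mathrm{prem}^\gamma((i,g)\in\mathrm{ar}^\gamma(r,f))=(\mathrm{prem}(r,i),g)$ and $\mathrm{ccl}^\gamma(r,f)=(\mathrm{ccl}(r),f)$. Then $P^\gamma=(\mathrm{Jdg}^\gamma\xleftarrow{\mathrm{prem}^\gamma}\int\mathrm{ar}^\gamma\xrightarrow{q_{\mathrm{ar}^\gamma}}R^\gamma\xrightarrow{\mathrm{ccl}^\gamma}\mathrm{Jdg}^\gamma)$ is a proof system and the forgetful functors form a morphism $u^\gamma=(u^\gamma,u_1^\gamma,u_2^\gamma)\colon P^\gamma\to P$ in $\mathbf{VPoly}$. -}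

module Defs where

open import Level using (Level; suc)
open import Axiom.Extensionality.Propositional
  using (Extensionality; implicit-extensionality)
open import Axiom.UniquenessOfIdentityProofs.WithK using (uip)
open import Data.Irrelevant using (Irrelevant; [_])
open import Data.Nat.Base as ℕ using (ℕ)
open import Data.Product using (Σ; Σ-syntax; ∃-syntax; _×_; _,_; proj₁; proj₂)
open import Data.Sum.Base using (_⊎_; inj₁; inj₂)
open import Data.Unit.Polymorphic.Base using (⊤)
open import Induction.WellFounded using (WellFounded)
open import Relation.Binary.Core using (Rel)
open import Relation.Binary.PropositionalEquality
  using (_≡_; refl; sym; trans; cong; subst)
open import Relation.Binary.Structures using (IsStrictTotalOrder)

private
  variable
    ℓ : Level

-- Small categories are strict: both objects and arrows form sets (axiom
-- K is on), and "small" means living in the universe Set ℓ.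

record Category (ℓ : Level) : Set (suc ℓ) where
  infixr 9 _∘_
  field
    Obj       : Set ℓ
    Hom       : Obj → Obj → Set ℓ
    id        : ∀ {x} → Hom x x
    _∘_       : ∀ {x y z} → Hom y z → Hom x y → Hom x z
    identityˡ : ∀ {x y} (f : Hom x y) → id ∘ f ≡ f
    identityʳ : ∀ {x y} (f : Hom x y) → f ∘ id ≡ f
    assoc     : ∀ {w x y z} (h : Hom y z) (g : Hom x y) (f : Hom w x) →
                (h ∘ g) ∘ f ≡ h ∘ (g ∘ f)

  coe : ∀ {x y} → x ≡ y → Hom x y
  coe refl = id

open Category public using (Obj; Hom)

-- Equality in the set of all arrows of C: the endpoints are part of the
-- data, so C [ f ≋ g ] also says that domains and codomains agree.

infix 4 _[_≋_]
data _[_≋_] (C : Category ℓ) {x y} (f : Hom C x y) :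
            ∀ {x′ y′} → Hom C x′ y′ → Set ℓ where
  refl : C [ f ≋ f ]

module _ {C : Category ℓ} where
  open Category C using (id; _∘_; coe; identityˡ; identityʳ)

  ≋-dom : ∀ {x y x′ y′} {f : Hom C x y} {g : Hom C x′ y′} →
          C [ f ≋ g ] → x ≡ x′
  ≋-dom refl = refl

  ≋-cod : ∀ {x y x′ y′} {f : Hom C x y} {g : Hom C x′ y′} →
          C [ f ≋ g ] → y ≡ y′
  ≋-cod refl = refl

  ≋⇒≡ : ∀ {x y} {f g : Hom C x y} → C [ f ≋ g ] → f ≡ g
  ≋⇒≡ refl = refl

  ≡⇒≋ : ∀ {x y} {f g : Hom C x y} → f ≡ g → C [ f ≋ g ]
  ≡⇒≋ refl = refl

  ≋-sym : ∀ {x y x′ y′} {f : Hom C x y} {g : Hom C x′ y′} →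
          C [ f ≋ g ] → C [ g ≋ f ]
  ≋-sym refl = refl

  infixr 5 _⟫_
  _⟫_ : ∀ {x y x′ y′ x″ y″}
          {f : Hom C x y} {g : Hom C x′ y′} {h : Hom C x″ y″} →
        C [ f ≋ g ] → C [ g ≋ h ] → C [ f ≋ h ]
  refl ⟫ q = q

  ∘-cong : ∀ {x y z x′ y′ z′} {g : Hom C y z} {f : Hom C x y}
             {g′ : Hom C y′ z′} {f′ : Hom C x′ y′} →
           C [ g ≋ g′ ] → C [ f ≋ f′ ] → C [ g ∘ f ≋ g′ ∘ f′ ]
  ∘-cong refl refl = refl

  ∘-coe : ∀ {x y z} (f : Hom C y z) (p : x ≡ y) → C [ f ∘ coe p ≋ f ]
  ∘-coe f refl = ≡⇒≋ (identityʳ f)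

  coe-∘ : ∀ {x y z} (p : y ≡ z) (f : Hom C x y) → C [ coe p ∘ f ≋ f ]
  coe-∘ refl f = ≡⇒≋ (identityˡ f)

  id-cong : ∀ {x y} → x ≡ y → C [ id {x} ≋ id {y} ]
  id-cong refl = refl

  coe≋id : ∀ {x y} (p : x ≡ y) → C [ coe p ≋ id {y} ]
  coe≋id refl = refl

record Functor (C D : Category ℓ) : Set ℓ where
  private
    module C = Category C
    module D = Category D
  field
    F₀           : Obj C → Obj D
    F₁           : ∀ {x y} → Hom C x y → Hom D (F₀ x) (F₀ y)
    identity     : ∀ {x} → F₁ (C.id {x}) ≡ D.id
    homomorphism : ∀ {x y z} (g : Hom C y z) (f : Hom C x y) →
                   F₁ (g C.∘ f) ≡ F₁ g D.∘ F₁ f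

open Functor public using (F₀; F₁)

idF : {C : Category ℓ} → Functor C C
idF = record
  { F₀ = λ x → x ; F₁ = λ f → f ; identity = refl ; homomorphism = λ _ _ → refl }

infixr 9 _∘F_
_∘F_ : {C D E : Category ℓ} → Functor D E → Functor C D → Functor C E
G ∘F F = record
  { F₀           = λ x → F₀ G (F₀ F x)
  ; F₁           = λ f → F₁ G (F₁ F f)
  ; identity     = trans (cong (F₁ G) (Functor.identity F)) (Functor.identity G)
  ; homomorphism = λ g f → trans (cong (F₁ G) (Functor.homomorphism F g f))
                                 (Functor.homomorphism G (F₁ F g) (F₁ F f))
  }

infix 4 _≡F_
record _≡F_ {C D : Category ℓ} (F G : Functor C D) : Set ℓ where
  field
    objects : ∀ x → F₀ F x ≡ F₀ G x
    arrows  : ∀ {x y} (f : Hom C x y) → D [ F₁ F f ≋ F₁ G f ]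

open _≡F_ public

module _ {C D : Category ℓ} (F : Functor C D) where
  private
    module C = Category C
    module D = Category D

  F₁-cong : ∀ {x y x′ y′} {f : Hom C x y} {g : Hom C x′ y′} →
            C [ f ≋ g ] → D [ F₁ F f ≋ F₁ F g ]
  F₁-cong refl = refl

  F₁-coe : ∀ {x y} (p : x ≡ y) (q : F₀ F x ≡ F₀ F y) →
           F₁ F (C.coe p) ≡ D.coe q
  F₁-coe refl refl = Functor.identity F

𝟙 : Category ℓ
𝟙 = record
  { Obj = ⊤ ; Hom = λ _ _ → ⊤ ; id = _ ; _∘_ = _
  ; identityˡ = λ _ → refl ; identityʳ = λ _ → refl ; assoc = λ _ _ _ → refl }

const : {C : Category ℓ} → Obj C → Functor 𝟙 C
const {C = C} x = record
  { F₀ = λ _ → x ; F₁ = λ _ → Category.id C ; identity = refl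
  ; homomorphism = λ _ _ → sym (Category.identityˡ C _) }

-- The square  U ∘F T′ ≡F T ∘F V  is a pullback in the category of small
-- categories.

record IsPullback {A′ A J′ J : Category ℓ}
                  (T′ : Functor J′ A′) (U : Functor A′ A)
                  (V : Functor J′ J) (T : Functor J A) : Set (suc ℓ) where
  field
    commutes  : U ∘F T′ ≡F T ∘F V
    universal : ∀ {X : Category ℓ} (F : Functor X A′) (G : Functor X J) →
                U ∘F F ≡F T ∘F G → Functor X J′
    fst-β     : ∀ {X} F G e → T′ ∘F universal {X} F G e ≡F F
    snd-β     : ∀ {X} F G e → V ∘F universal {X} F G e ≡F G
    unique    : ∀ {X} F G e (H : Functor X J′) →
                T′ ∘F H ≡F F → V ∘F H ≡F G → H ≡F universal {X} F G e

record Presheaf (C : Category ℓ) : Set (suc ℓ) where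
  private module C = Category C
  field
    Ob           : Obj C → Set ℓ
    act          : ∀ {x y} → Hom C x y → Ob y → Ob x
    identity     : ∀ {x} (n : Ob x) → act C.id n ≡ n
    homomorphism : ∀ {x y z} (g : Hom C y z) (f : Hom C x y) (n : Ob z) →
                   act (g C.∘ f) n ≡ act f (act g n)

open Presheaf public using (Ob; act)

infix 4 _⇒_
record _⇒_ {C : Category ℓ} (X Y : Presheaf C) : Set ℓ where
  field
    η       : ∀ {x} → Ob X x → Ob Y x
    natural : ∀ {x y} (f : Hom C x y) (n : Ob X y) →
              η (act X f n) ≡ act Y f (η n)

open _⇒_ public using (η)

infixr 9 _∘⇒_
_∘⇒_ : {C : Category ℓ} {X Y Z : Presheaf C} → Y ⇒ Z → X ⇒ Y → X ⇒ Z
β ∘⇒ α = record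
  { η       = λ n → η β (η α n)
  ; natural = λ f n → trans (cong (η β) (_⇒_.natural α f n))
                            (_⇒_.natural β f (η α n))
  }

infixr 10 _^*_
_^*_ : {C D : Category ℓ} → Functor C D → Presheaf D → Presheaf C
F ^* X = record
  { Ob           = λ x → Ob X (F₀ F x)
  ; act          = λ f → act X (F₁ F f)
  ; identity     = λ n → trans (cong (λ g → act X g n) (Functor.identity F))
                               (Presheaf.identity X n)
  ; homomorphism = λ g f n →
      trans (cong (λ h → act X h n) (Functor.homomorphism F g f))
            (Presheaf.homomorphism X (F₁ F g) (F₁ F f) n)
  }

_^*₁_ : {C D : Category ℓ} (F : Functor C D) {X Y : Presheaf D} →
        X ⇒ Y → F ^* X ⇒ F ^* Y
F ^*₁ α = record { η = η α ; natural = λ f → _⇒_.natural α (F₁ F f) }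

∫ : {C : Category ℓ} → Presheaf C → Category ℓ
∫ {C = C} X = record
  { Obj       = Σ (Obj C) (Ob X)
  ; Hom       = λ { (x , n) (y , m) → Σ[ f ∈ Hom C x y ] act X f m ≡ n }
  ; id        = C.id , Presheaf.identity X _
  ; _∘_       = λ { (g , q) (f , p) →
                  (g C.∘ f) , trans (Presheaf.homomorphism X g f _)
                                    (trans (cong (act X f) q) p) }
  ; identityˡ = λ f → hom≡ (C.identityˡ (proj₁ f))
  ; identityʳ = λ f → hom≡ (C.identityʳ (proj₁ f))
  ; assoc     = λ h g f → hom≡ (C.assoc (proj₁ h) (proj₁ g) (proj₁ f))
  }
  where
  module C = Category C
  hom≡ : ∀ {x y n m} {f g : Σ[ h ∈ Hom C x y ] act X h m ≡ n} →
         proj₁ f ≡ proj₁ g → f ≡ g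
  hom≡ {f = f , p} {g = .f , q} refl = cong (f ,_) (uip p q)

proj : {C : Category ℓ} (X : Presheaf C) → Functor (∫ X) C
proj X = record
  { F₀ = proj₁ ; F₁ = proj₁ ; identity = refl ; homomorphism = λ _ _ → refl }

record IsDiscreteFibration {E B : Category ℓ} (t : Functor E B) : Set ℓ where
  field
    dom    : ∀ e {b} → Hom B b (F₀ t e) → Obj E
    lift   : ∀ e {b} (g : Hom B b (F₀ t e)) → Hom E (dom e g) e
    over   : ∀ e {b} (g : Hom B b (F₀ t e)) → B [ F₁ t (lift e g) ≋ g ]
    unique : ∀ e {b} (g : Hom B b (F₀ t e)) {e′} (k : Hom E e′ e) →
             B [ F₁ t k ≋ g ] → E [ k ≋ lift e g ]

record IsTwoSidedDiscreteFibration
         {I A B : Category ℓ} (s : Functor I A) (q : Functor I B) : Set ℓ where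
  private
    module I = Category I
    module A = Category A
    module B = Category B
  field
    dom     : ∀ i {a} → Hom A a (F₀ s i) → Obj I
    liftˢ   : ∀ i {a} (g : Hom A a (F₀ s i)) → Hom I (dom i g) i
    overˢ   : ∀ i {a} (g : Hom A a (F₀ s i)) →
              A [ F₁ s (liftˢ i g) ≋ g ] × B [ F₁ q (liftˢ i g) ≋ B.id {F₀ q i} ]
    uniqueˢ : ∀ i {a} (g : Hom A a (F₀ s i)) {i′} (k : Hom I i′ i) →
              A [ F₁ s k ≋ g ] → B [ F₁ q k ≋ B.id {F₀ q i} ] →
              I [ k ≋ liftˢ i g ]

    cod     : ∀ i {b} → Hom B (F₀ q i) b → Obj I
    liftᑫ   : ∀ i {b} (g : Hom B (F₀ q i) b) → Hom I i (cod i g)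
    overᑫ   : ∀ i {b} (g : Hom B (F₀ q i) b) →
              B [ F₁ q (liftᑫ i g) ≋ g ] × A [ F₁ s (liftᑫ i g) ≋ A.id {F₀ s i} ]
    uniqueᑫ : ∀ i {b} (g : Hom B (F₀ q i) b) {i′} (k : Hom I i i′) →
              B [ F₁ q k ≋ g ] → A [ F₁ s k ≋ A.id {F₀ s i} ] →
              I [ k ≋ liftᑫ i g ]

    meet    : ∀ {i j} (f : Hom I i j) → cod i (F₁ q f) ≡ dom j (F₁ s f)
    factor  : ∀ {i j} (f : Hom I i j) →
              liftˢ j (F₁ s f) I.∘ (I.coe (meet f) I.∘ liftᑫ i (F₁ q f)) ≡ f

-- A diagram A ← I → J → A whose last leg is a discrete fibration; this is
-- all that the definitions of t_! q_* s^* and of the transformation τ use.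
-- It is a polynomial when IsPolynomial holds.

record Diagram (A : Category ℓ) : Set (suc ℓ) where
  field
    I J   : Category ℓ
    s     : Functor I A
    q     : Functor I J
    t     : Functor J A
    t-fib : IsDiscreteFibration t

IsPolynomial : {A : Category ℓ} → Diagram A → Set ℓ
IsPolynomial D = IsTwoSidedDiscreteFibration s q
  where open Diagram D

-- Morphisms of VPoly with prescribed component u on the base; the conditions
-- do not mention the two-sided fibrations.

record VPolyHom {A′ A : Category ℓ} (u : Functor A′ A)
                (D′ : Diagram A′) (D : Diagram A) : Set (suc ℓ) where
  private
    module D′ = Diagram D′
    module D  = Diagram D
  field
    u₁       : Functor D′.I D.I
    u₂       : Functor D′.J D.J
    s-square : u ∘F D′.s ≡F D.s ∘F u₁
    q-square : u₂ ∘F D′.q ≡F D.q ∘F u₁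
    t-square : IsPullback D′.t u u₂ D.t

-- Function extensionality is needed for the presheaf laws of q_* H, whose
-- values are sets of families.

module Familial {ℓ : Level} (ext : Extensionality ℓ ℓ) where

  -- Right Kan extension along q^op: q_* H at j is the set of natural
  -- transformations J(q -, j) ⇒ H.

  module _ {I J : Category ℓ} (q : Functor I J) where
    private
      module I = Category I
      module J = Category J

    record RanOb (H : Presheaf I) (j : Obj J) : Set ℓ where
      constructor family
      field
        at      : ∀ i → Hom J (F₀ q i) j → Ob H i
        natural : ∀ {i i′} (f : Hom I i i′) (m : Hom J (F₀ q i′) j) →
                  at i (m J.∘ F₁ q f) ≡ act H f (at i′ m)

    open RanOb public using (at)

    family≡ : ∀ {H j} {v w : RanOb H j} →
              (∀ i m → at v i m ≡ at w i m) → v ≡ w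
    family≡ {H} {j} {family a x} {family b y} e = go (ext λ i → ext (e i)) x y
      where
      Natural : (∀ i → Hom J (F₀ q i) j → Ob H i) → Set ℓ
      Natural a = ∀ {i i′} (f : Hom I i i′) (m : Hom J (F₀ q i′) j) →
                  a i (m J.∘ F₁ q f) ≡ act H f (a i′ m)
      go : ∀ {a b} → a ≡ b → (x : Natural a) (y : Natural b) →
           family {H} a x ≡ family b y
      go {a} refl x y = cong (λ (z : Natural a) → family a z)
        (implicit-extensionality ext (implicit-extensionality ext
          (ext λ f → ext λ m → uip (x f m) (y f m))))

    Ran : Presheaf I → Presheaf J
    Ran H = record
      { Ob           = RanOb H
      ; act          = λ h v → record
          { at      = λ i m → at v i (h J.∘ m)
          ; natural = λ f m → trans (cong (at v _) (sym (J.assoc h m (F₁ q f))))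
                                    (RanOb.natural v f (h J.∘ m))
          }
      ; identity     = λ v → family≡ λ i m → cong (at v i) (J.identityˡ m)
      ; homomorphism = λ g f v → family≡ λ i m → cong (at v i) (J.assoc g f m)
      }

    Ran₁ : ∀ {G H} → G ⇒ H → Ran G ⇒ Ran H
    Ran₁ α = record
      { η       = λ v → record
          { at      = λ i m → η α (at v i m)
          ; natural = λ f m → trans (cong (η α) (RanOb.natural v f m))
                                    (_⇒_.natural α f _)
          }
      ; natural = λ f v → family≡ λ i m → refl
      }

  -- Left Kan extension along t^op for a discrete fibration t: t_! H at a is
  -- the coproduct of H over the fibre of t at a.

  module _ {J A : Category ℓ} {t : Functor J A} (fib : IsDiscreteFibration t)
           where
    private
      module J = Category J
      module A = Category A
      module fib = IsDiscreteFibration fib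

    module _ (H : Presheaf J) where

      record LanOb (a : Obj A) : Set ℓ where
        constructor summand
        field
          index : Obj J
          over  : F₀ t index ≡ a
          val   : Ob H index

      Lan-act : ∀ {b a} → Hom A b a → LanOb a → LanOb b
      Lan-act g (summand j refl v) =
        summand (fib.dom j g) (≋-dom (fib.over j g)) (act H (fib.lift j g) v)

      Lan-act-by : ∀ {b a} (g : Hom A b a) {j j′} {p : F₀ t j ≡ a}
                   {p′ : F₀ t j′ ≡ b} {v : Ob H j} (k : Hom J j′ j) →
                   A [ F₁ t k ≋ g ] →
                   Lan-act g (summand j p v) ≡ summand j′ p′ (act H k v)
      Lan-act-by g {j} {j′} {refl} {p′} {v} k e =
        go (fib.unique j g k e) (≋-dom (fib.over j g)) p′
        where
        go : ∀ {i b} {l : Hom J i j} → J [ k ≋ l ] →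
             (p : F₀ t i ≡ b) (p′ : F₀ t j′ ≡ b) →
             summand i p (act H l v) ≡ summand j′ p′ (act H k v)
        go refl p p′ = cong (λ p → summand j′ p (act H k v)) (uip p p′)

      Lan : Presheaf A
      Lan = record
        { Ob           = LanOb
        ; act          = Lan-act
        ; identity     = λ { (summand j refl v) →
            trans (Lan-act-by A.id {p′ = refl} J.id (≡⇒≋ (Functor.identity t)))
                  (cong (summand j refl) (Presheaf.identity H v)) }
        ; homomorphism = λ { g f (summand j refl v) →
            let k  = fib.lift j g
                p  = ≋-dom (fib.over j g)
                g′ = A.coe (sym p) A.∘ f
                k′ = fib.lift (fib.dom j g) g′
                e′ = fib.over (fib.dom j g) g′ ⟫ coe-∘ (sym p) f
            in trans (Lan-act-by (g A.∘ f) {p′ = ≋-dom e′} (k J.∘ k′)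
                       (≡⇒≋ (Functor.homomorphism t k k′)
                        ⟫ ∘-cong (fib.over j g) e′))
               (trans (cong (summand _ _) (Presheaf.homomorphism H k k′ v))
                      (sym (Lan-act-by f k′ e′))) }
        }

    Lan₁ : ∀ {G H} → G ⇒ H → Lan G ⇒ Lan H
    Lan₁ α = record
      { η       = λ { (summand j p v) → summand j p (η α v) }
      ; natural = λ { f (summand j refl v) →
                    cong (summand _ _) (_⇒_.natural α _ v) }
      }

  open LanOb public using (index; val)

  F[_] : {A : Category ℓ} → Diagram A → Presheaf A → Presheaf A
  F[ D ] G = Lan t-fib (Ran q (s ^* G))
    where open Diagram D

  F[_]₁ : {A : Category ℓ} (D : Diagram A) {G H : Presheaf A} →
          G ⇒ H → F[ D ] G ⇒ F[ D ] H
  F[ D ]₁ α = Lan₁ t-fib (Ran₁ q (s ^*₁ α))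
    where open Diagram D

  record Coalgebra {A : Category ℓ} (D : Diagram A) : Set (suc ℓ) where
    field
      carrier   : Presheaf A
      structure : carrier ⇒ F[ D ] carrier

  IsRecursive : {A : Category ℓ} {D : Diagram A} → Coalgebra D → Set (suc ℓ)
  IsRecursive {A} {D} c =
    ∀ (X : Presheaf A) (a : F[ D ] X ⇒ X) →
    Σ[ h ∈ carrier ⇒ X ] Solves a h ×
      (∀ (h′ : carrier ⇒ X) → Solves a h′ → ∀ {x} (n : Ob carrier x) → η h′ n ≡ η h n)
    where
    open Coalgebra c
    Solves : ∀ {X} → F[ D ] X ⇒ X → carrier ⇒ X → Set ℓ
    Solves a h = ∀ {x} (n : Ob carrier x) →
                 η h n ≡ η a (η (F[ D ]₁ h) (η structure n))

  -- The transformation τ : u^* F[D] ⇒ F[D′] u^* and the functor Coalg(u^*).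

  module _ {A′ A : Category ℓ} {u : Functor A′ A}
           {D′ : Diagram A′} {D : Diagram A} (φ : VPolyHom u D′ D) where
    private
      module A′ = Category A′
      module A  = Category A
      module D′ = Diagram D′
      module D  = Diagram D
      module I  = Category D.I
      module J  = Category D.J
      module J′ = Category D′.J
      open VPolyHom φ
      module pb = IsPullback t-square

    square : ∀ {a j} → F₀ D.t j ≡ F₀ u a →
             u ∘F const {C = A′} a ≡F D.t ∘F const {C = D.J} j
    square e = record
      { objects = λ _ → sym e
      ; arrows  = λ _ → ≡⇒≋ (Functor.identity u) ⟫ id-cong (sym e)
                        ⟫ ≡⇒≋ (sym (Functor.identity D.t)) }

    -- the unique j′ with t′(j′) = a and u₂(j′) = j
    over : ∀ {a j} → F₀ D.t j ≡ F₀ u a → Functor 𝟙 D′.J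
    over {a} {j} e = pb.universal (const a) (const j) (square e)

    idx : ∀ {a j} → F₀ D.t j ≡ F₀ u a → Obj D′.J
    idx e = F₀ (over e) _

    idx-t : ∀ {a j} (e : F₀ D.t j ≡ F₀ u a) → F₀ D′.t (idx e) ≡ a
    idx-t e = objects (pb.fst-β _ _ (square e)) _

    idx-u₂ : ∀ {a j} (e : F₀ D.t j ≡ F₀ u a) → F₀ u₂ (idx e) ≡ j
    idx-u₂ e = objects (pb.snd-β _ _ (square e)) _

    const-≡F : ∀ {C B : Category ℓ} (G : Functor C B) {x y} → F₀ G x ≡ y →
               G ∘F const {C = C} x ≡F const {C = B} y
    const-≡F G e = record
      { objects = λ _ → e
      ; arrows  = λ _ → ≡⇒≋ (Functor.identity G) ⟫ id-cong e }

    idx-unique : ∀ {a j} (e : F₀ D.t j ≡ F₀ u a) {k} →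
                 F₀ D′.t k ≡ a → F₀ u₂ k ≡ j → k ≡ idx e
    idx-unique e {k} p r = objects
      (pb.unique _ _ (square e) (const k) (const-≡F D′.t p) (const-≡F u₂ r)) _

    -- u₂ m′ : u₂(q′(i′)) → u₂(j′), read as an arrow q(u₁(i′)) → j
    arr : ∀ {j j′ i′} → F₀ u₂ j′ ≡ j → Hom D′.J (F₀ D′.q i′) j′ →
          Hom D.J (F₀ D.q (F₀ u₁ i′)) j
    arr {i′ = i′} r m =
      J.coe r J.∘ (F₁ u₂ m J.∘ J.coe (sym (objects q-square i′)))

    arr≋ : ∀ {j j′ i′} (r : F₀ u₂ j′ ≡ j) (m : Hom D′.J (F₀ D′.q i′) j′) →
           D.J [ arr r m ≋ F₁ u₂ m ]
    arr≋ {i′ = i′} r m = coe-∘ r _ ⟫ ∘-coe (F₁ u₂ m) (sym (objects q-square i′))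

    module _ (X : Presheaf A) where
      private module X = Presheaf X

      restrict : ∀ {j j′} → F₀ u₂ j′ ≡ j → RanOb D.q (D.s ^* X) j →
                 RanOb D′.q (D′.s ^* (u ^* X)) j′
      restrict r v = record
        { at      = λ i m → act X (A.coe (objects s-square i)) (at v (F₀ u₁ i) (arr r m))
        ; natural = λ {i} {i′} f m →
            trans (cong (act X (A.coe (objects s-square i)))
              (trans (cong (at v (F₀ u₁ i)) (≋⇒≡
                (arr≋ r (m J′.∘ F₁ D′.q f)
                 ⟫ ≡⇒≋ (Functor.homomorphism u₂ m (F₁ D′.q f))
                 ⟫ ∘-cong (≋-sym (arr≋ r m)) (arrows q-square f))))
                (RanOb.natural v (F₁ u₁ f) (arr r m))))
            (trans (sym (X.homomorphism _ _ _))
            (trans (cong (λ g → act X g (at v (F₀ u₁ i′) (arr r m))) (≋⇒≡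
                (∘-coe _ (objects s-square i) ⟫ ≋-sym (arrows s-square f)
                 ⟫ ≋-sym (coe-∘ (objects s-square i′) _))))
              (X.homomorphism _ _ _)))
        }

      restrict≡ : ∀ {a j j₁ j′ j₁′} {v : RanOb D.q (D.s ^* X) j}
                  (k : Hom D.J j₁ j) (k′ : Hom D′.J j₁′ j′)
                  (r : F₀ u₂ j′ ≡ j) {j₂′} (r₁ : F₀ u₂ j₂′ ≡ j₁) →
                  D.J [ F₁ u₂ k′ ≋ k ] → (e : j₁′ ≡ j₂′) →
                  ∀ {p₁ : F₀ D′.t j₂′ ≡ a} {p₂ : F₀ D′.t j₁′ ≡ a} →
                  summand {fib = D′.t-fib} {H = Ran D′.q (D′.s ^* (u ^* X))} j₂′ p₁ (restrict r₁ (act (Ran D.q (D.s ^* X)) k v))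
                  ≡ summand j₁′ p₂ (act (Ran D′.q (D′.s ^* (u ^* X))) k′ (restrict r v))
      restrict≡ {v = v} k k′ r r₁ κ refl {p₁} {p₂} =
        trans (cong (λ p → summand _ p _) (uip p₁ p₂))
          (cong (summand _ p₂) (family≡ _ λ i m →
            cong (act X _) (cong (at v _) (≋⇒≡
              (∘-cong (≋-sym κ) (arr≋ r₁ m)
               ⟫ ≡⇒≋ (sym (Functor.homomorphism u₂ k′ m))
               ⟫ ≋-sym (arr≋ r (k′ J′.∘ m)))))))

    module _ (X : Presheaf A) where
      private
        module fib′ = IsDiscreteFibration D′.t-fib
        H = Ran D.q (D.s ^* X)
        H′ = Ran D′.q (D′.s ^* (u ^* X))

      τη : ∀ {a} → LanOb D.t-fib H (F₀ u a) → LanOb D′.t-fib H′ a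
      τη (summand j p v) = summand (idx p) (idx-t p) (restrict X (idx-u₂ p) v)

      τ-natural : ∀ {b a} (f : Hom A′ b a) (x : LanOb D.t-fib H (F₀ u a)) →
                  τη (Lan-act D.t-fib H (F₁ u f) x) ≡
                  Lan-act D′.t-fib H′ f (τη x)
      τ-natural f (summand j p v) =
        trans (cong τη (Lan-act-by D.t-fib H (F₁ u f) {p = p} {p′} {v} k e))
        (trans (restrict≡ X {v = v} k k′ (idx-u₂ p) (idx-u₂ p′)
                 (≋-sym (coe-∘ (idx-u₂ p) (F₁ u₂ k′)))
                 (idx-unique p′ (≋-dom e′) refl))
               (sym (Lan-act-by D′.t-fib H′ f {p = idx-t p} {≋-dom e′}
                       {restrict X (idx-u₂ p) v} k′ e′)))
        where
        f′ = A′.coe (sym (idx-t p)) A′.∘ f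
        k′ = fib′.lift (idx p) f′
        e′ : A′ [ F₁ D′.t k′ ≋ f ]
        e′ = fib′.over (idx p) f′ ⟫ coe-∘ (sym (idx-t p)) f
        k = J.coe (idx-u₂ p) J.∘ F₁ u₂ k′
        e : A [ F₁ D.t k ≋ F₁ u f ]
        e = F₁-cong D.t (coe-∘ (idx-u₂ p) (F₁ u₂ k′))
            ⟫ ≋-sym (arrows pb.commutes k′) ⟫ F₁-cong u e′
        p′ = ≋-dom e

    τ : (X : Presheaf A) → u ^* F[ D ] X ⇒ F[ D′ ] (u ^* X)
    τ X = record { η = τη X ; natural = τ-natural X }

    Coalg : Coalgebra D → Coalgebra D′
    Coalg c = record
      { carrier   = u ^* carrier
      ; structure = τ carrier ∘⇒ (u ^*₁ structure)
      }
      where open Coalgebra c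

record CatFunctor (R : Category ℓ) : Set (suc ℓ) where
  private module R = Category R
  field
    fibre        : Obj R → Category ℓ
    map          : ∀ {r r′} → Hom R r r′ → Functor (fibre r) (fibre r′)
    identity     : ∀ {r} → map (R.id {r}) ≡F idF
    homomorphism : ∀ {r r′ r″} (g : Hom R r′ r″) (f : Hom R r r′) →
                   map (g R.∘ f) ≡F map g ∘F map f

module Grothendieck {ℓ : Level} {R : Category ℓ} (ar : CatFunctor R) where
  private module R = Category R
  open CatFunctor ar

  private
    module A {r} = Category (fibre r)

  ∫ᵒ : Set ℓ
  ∫ᵒ = Σ[ r ∈ Obj R ] Obj (fibre r)

  record ∫Hom (x y : ∫ᵒ) : Set ℓ where
    constructor _,_
    field
      base : Hom R (proj₁ x) (proj₁ y)
      vert : Hom (fibre (proj₁ y)) (F₀ (map base) (proj₂ x)) (proj₂ y)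

  open ∫Hom public

  ∫Hom≡ : ∀ {x y} {f g : ∫Hom x y} → base f ≡ base g →
          fibre (proj₁ y) [ vert f ≋ vert g ] → f ≡ g
  ∫Hom≡ {f = h , k} {g = .h , k′} refl e = cong (h ,_) (≋⇒≡ e)

  ∫id : ∀ {x} → ∫Hom x x
  ∫id {r , i} = R.id , A.coe (objects identity i)

  infixr 9 _∙_
  _∙_ : ∀ {x y z} → ∫Hom y z → ∫Hom x y → ∫Hom x z
  _∙_ {x = _ , i} (h′ , k′) (h , k) =
    (h′ R.∘ h) , (k′ A.∘ (F₁ (map h′) k A.∘ A.coe (objects (homomorphism h′ h) i)))

  ∙-vert : ∀ {x y z} (g : ∫Hom y z) (f : ∫Hom x y) →
           fibre (proj₁ z) [ vert (g ∙ f) ≋ vert g A.∘ F₁ (map (base g)) (vert f) ]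
  ∙-vert {x = _ , i} g f =
    ∘-cong refl (∘-coe (F₁ (map (base g)) (vert f)) (objects (homomorphism (base g) (base f)) i))

  ∫ᶜ : Category ℓ
  ∫ᶜ = record
    { Obj       = ∫ᵒ
    ; Hom       = ∫Hom
    ; id        = ∫id
    ; _∘_       = _∙_
    ; identityˡ = λ { {y = _ , i} f → ∫Hom≡ (R.identityˡ (base f))
        (∙-vert ∫id f ⟫ coe-∘ (objects identity i) _ ⟫ arrows identity (vert f)) }
    ; identityʳ = λ { {x = _ , i} f → ∫Hom≡ (R.identityʳ (base f))
        (∙-vert f ∫id
         ⟫ ∘-cong refl (F₁-cong (map (base f)) (coe≋id (objects identity i))
                        ⟫ ≡⇒≋ (Functor.identity (map (base f))))
         ⟫ ≡⇒≋ (A.identityʳ (vert f))) }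
    ; assoc     = λ h g f → ∫Hom≡ (R.assoc (base h) (base g) (base f))
        (∙-vert (h ∙ g) f
         ⟫ ∘-cong (∙-vert h g) (arrows (homomorphism (base h) (base g)) (vert f))
         ⟫ ≡⇒≋ (A.assoc (vert h) _ _)
         ⟫ ∘-cong refl
             (≡⇒≋ (sym (Functor.homomorphism (map (base h)) (vert g) _))
              ⟫ F₁-cong (map (base h)) (≋-sym (∙-vert g f)))
         ⟫ ≋-sym (∙-vert h (g ∙ f)))
    }

  q-ar : Functor ∫ᶜ R
  q-ar = record
    { F₀ = proj₁ ; F₁ = base ; identity = refl ; homomorphism = λ _ _ → refl }

  cart : ∀ {r r′} (h : Hom R r r′) (i : Obj (fibre r)) →
         ∫Hom (r , i) (r′ , F₀ (map h) i)
  cart h i = h , A.id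

  incl : ∀ {r} {i j : Obj (fibre r)} → Hom (fibre r) i j → ∫Hom (r , i) (r , j)
  incl {i = i} k = R.id , (k A.∘ A.coe (objects identity i))

  incl-vert : ∀ {r} {i j : Obj (fibre r)} (k : Hom (fibre r) i j) →
              fibre r [ vert (incl k) ≋ k ]
  incl-vert {i = i} k = ∘-coe k (objects identity i)

  incl-id : ∀ {r} {i : Obj (fibre r)} → incl (A.id {r} {i}) ≡ ∫id
  incl-id {i = i} = ∫Hom≡ refl (≡⇒≋ (A.identityˡ _))

  incl-∘ : ∀ {r} {i j l : Obj (fibre r)} (k′ : Hom (fibre r) j l)
           (k : Hom (fibre r) i j) → incl (k′ A.∘ k) ≡ incl k′ ∙ incl k
  incl-∘ k′ k = ∫Hom≡ (sym (R.identityˡ R.id))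
    (incl-vert (k′ A.∘ k)
     ⟫ ∘-cong (≋-sym (incl-vert k′))
              (≋-sym (incl-vert k) ⟫ ≋-sym (arrows identity (vert (incl k))))
     ⟫ ≋-sym (∙-vert (incl k′) (incl k)))

  incl-cart : ∀ {r r′ i j} (f : ∫Hom (r , i) (r′ , j)) →
              incl (vert f) ∙ cart (base f) i ≡ f
  incl-cart f = ∫Hom≡ (R.identityˡ (base f))
    (∙-vert (incl (vert f)) (cart (base f) _)
     ⟫ ∘-cong (incl-vert (vert f)) (arrows identity A.id)
     ⟫ ≡⇒≋ (A.identityʳ (vert f)))

  cart-natural : ∀ {r r′} (h : Hom R r r′) {i j} (k : Hom (fibre r) i j) →
                 cart h j ∙ incl k ≡ incl (F₁ (map h) k) ∙ cart h i
  cart-natural h k = trans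
    (sym (incl-cart (cart h _ ∙ incl k)))
    (trans (∫Hom≡ (trans (R.identityˡ _) (trans (R.identityʳ h) (sym (R.identityˡ h))))
              (∙-vert (incl (vert (cart h _ ∙ incl k))) (cart _ _)
               ⟫ ∘-cong (incl-vert _) (arrows identity A.id)
               ⟫ ≡⇒≋ (A.identityʳ _)
               ⟫ ∙-vert (cart h _) (incl k)
               ⟫ ≡⇒≋ (A.identityˡ _)
               ⟫ F₁-cong (map h) (incl-vert k)
               ⟫ ≡⇒≋ (sym (A.identityʳ _))
               ⟫ ∘-cong (≋-sym (incl-vert (F₁ (map h) k))) (≋-sym (arrows identity A.id))
               ⟫ ≋-sym (∙-vert (incl (F₁ (map h) k)) (cart h _))))
           refl)

  cart-id : ∀ {r} (i : Obj (fibre r)) → ∫ᶜ [ cart R.id i ≋ ∫id {r , i} ]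
  cart-id {r} i = go (objects identity i) refl
    where
    go : ∀ {j} (e : F₀ (map R.id) i ≡ j) {k : ∫Hom (r , i) (r , j)} →
         k ≡ (R.id , A.coe e) → ∫ᶜ [ cart R.id i ≋ k ]
    go refl refl = refl

  cart-∘ : ∀ {r r′ r″} (g : Hom R r′ r″) (f : Hom R r r′) (i : Obj (fibre r)) →
           ∫ᶜ [ cart (g R.∘ f) i ≋ cart g (F₀ (map f) i) ∙ cart f i ]
  cart-∘ {r} {r″ = r″} g f i =
    go (objects (homomorphism g f) i) refl
    ⟫ ≡⇒≋ (∫Hom≡ refl
        (coe≋id (objects (homomorphism g f) i)
         ⟫ ≡⇒≋ (sym (Functor.identity (map g)))
         ⟫ ≡⇒≋ (sym (A.identityˡ _))
         ⟫ ≋-sym (∙-vert (cart g _) (cart f i))))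
    where
    go : ∀ {j} (e : F₀ (map (g R.∘ f)) i ≡ j) {k : ∫Hom (r , i) (r″ , j)} →
         k ≡ (g R.∘ f , A.coe e) → ∫ᶜ [ cart (g R.∘ f) i ≋ k ]
    go refl refl = refl

record RuleSystem (Jdg : Category ℓ) : Set (suc ℓ) where
  field
    R       : Category ℓ
    ar      : CatFunctor R
  open Grothendieck ar public
  open CatFunctor ar public using () renaming (fibre to premises; map to ar₁)
  field
    prem    : Functor ∫ᶜ Jdg
    ccl     : Functor R Jdg
    ccl-fib : IsDiscreteFibration ccl

  diagram : Diagram Jdg
  diagram = record { s = prem ; q = q-ar ; t = ccl ; t-fib = ccl-fib }

-- The polynomial condition only makes prem (cart h i) an isomorphism.  That
-- prem (r , i) and prem (r′ , ar h i) are the same judgement is the further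
-- convention prem-cart: the lifts of h in the two-sided discrete fibration
-- are the arrows cart h i = (h , id) of the Grothendieck construction.

record ProofSystem (Jdg : Category ℓ) : Set (suc ℓ) where
  field
    rules : RuleSystem Jdg
  open RuleSystem rules public
  field
    isPolynomial : IsPolynomial diagram
    prem-cart    : ∀ {r r′} (h : Hom R r r′) (i : Obj (premises r)) →
                   Jdg [ F₁ prem (cart h i) ≋ Category.id Jdg {F₀ prem (r , i)} ]

-- By prem-cart, act fml (F₁ prem (cart h i)) below is the transport along the
-- equality prem (r₁ , i) ≡ prem (r₂ , ar h i).

record TraceStructure {Jdg : Category ℓ} (P : ProofSystem Jdg) : Set (suc ℓ) where
  private module P = ProofSystem P
  field
    fml : Presheaf Jdg
    T   : ProofSystem (∫ fml)
    π   : VPolyHom (proj fml) (ProofSystem.diagram T) P.diagram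
  private module T = ProofSystem T

  -- (s , φ) ⇝[ r , i ] (s′ , ψ) forces s ≡ ccl r and s′ ≡ prem (r , i).
  _⇝[_]_ : Obj (∫ fml) → P.∫ᵒ → Obj (∫ fml) → Set ℓ
  φ ⇝[ ri ] ψ = Σ[ i′ ∈ T.∫ᵒ ]
    F₀ (VPolyHom.u₁ π) i′ ≡ ri × F₀ T.prem i′ ≡ ψ × F₀ T.ccl (F₀ T.q-ar i′) ≡ φ

  field
    Prog   : Obj (∫ fml) → P.∫ᵒ → Obj (∫ fml) → Set ℓ
    Prog⊆⇝ : ∀ {φ ri ψ} → Prog φ ri ψ → φ ⇝[ ri ] ψ

    ⇝-pull : ∀ {r₁ r₂} (h : Hom P.R r₁ r₂) (i : Obj (P.premises r₁)) {φ ψ} →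
             let i₂ = F₀ (P.ar₁ h) i in
             (F₀ P.ccl r₂ , φ) ⇝[ r₂ , i₂ ] (F₀ P.prem (r₂ , i₂) , ψ) →
             (F₀ P.ccl r₁ , act fml (F₁ P.ccl h) φ) ⇝[ r₁ , i ]
             (F₀ P.prem (r₁ , i) , act fml (F₁ P.prem (P.cart h i)) ψ)

    Prog-pull : ∀ {r₁ r₂} (h : Hom P.R r₁ r₂) (i : Obj (P.premises r₁)) {φ ψ} →
                let i₂ = F₀ (P.ar₁ h) i in
                Prog (F₀ P.ccl r₂ , φ) (r₂ , i₂) (F₀ P.prem (r₂ , i₂) , ψ) →
                Prog (F₀ P.ccl r₁ , act fml (F₁ P.ccl h) φ) (r₁ , i)
                     (F₀ P.prem (r₁ , i) , act fml (F₁ P.prem (P.cart h i)) ψ)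

module _ (ext : Extensionality ℓ ℓ) where
  open Familial ext

  PreProof : {Jdg : Category ℓ} → ProofSystem Jdg → Set (suc ℓ)
  PreProof P = Coalgebra (ProofSystem.diagram P)

  module _ {Jdg : Category ℓ} {P : ProofSystem Jdg} (c : PreProof P) where
    open ProofSystem P
    open Coalgebra c

    Node : Set ℓ
    Node = Σ[ s ∈ Obj Jdg ] Ob carrier s

    rule : Node → Obj R
    rule (s , n) = index (η structure n)

    -- The component nᵢ of structure n = (r , ⟨nᵢ⟩) is the value of the family
    -- in (q_* prem^* carrier)(r) at i and the identity of r = q (r , i).
    child : (n : Node) → Obj (premises (rule n)) → Node
    child (s , n) i =
      F₀ prem (rule (s , n) , i) ,
      at (val (η structure n)) (rule (s , n) , i) (Category.id R)

    record Path : Set ℓ where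
      field
        node  : ℕ → Node
        label : ∀ k → Obj (premises (rule (node k)))
        edge  : ∀ k → node (ℕ.suc k) ≡ child (node k) (label k)

    suffix : ℕ → Path → Path
    suffix m p = record
      { node  = λ k → node (k ℕ.+ m)
      ; label = λ k → label (k ℕ.+ m)
      ; edge  = λ k → edge (k ℕ.+ m)
      }
      where open Path p

    module _ (t : TraceStructure P) where
      open TraceStructure t

      record Trace (p : Path) : Set ℓ where
        open Path p
        field
          formula : ∀ k → Ob fml (proj₁ (node k))

        at-node : ℕ → Obj (∫ fml)
        at-node k = proj₁ (node k) , formula k

        field
          step : ∀ k → at-node k ⇝[ rule (node k) , label k ] at-node (ℕ.suc k)

        InfinitelyProgressing : Set ℓ
        InfinitelyProgressing = ∀ m → ∃[ k ] m ℕ.≤ k ×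
          Prog (at-node k) (rule (node k) , label k) (at-node (ℕ.suc k))

      GTC : Set ℓ
      GTC = ∀ (p : Path) →
            ∃[ m ] Σ[ θ ∈ Trace (suffix m p) ] Trace.InfinitelyProgressing θ

-- An ordinal, identified with the set of its predecessors, is a well-ordered
-- set.

record Ordinal (ℓ : Level) : Set (suc ℓ) where
  infix 4 _<_ _≤_
  field
    Carrier            : Set ℓ
    _<_                : Rel Carrier ℓ
    isStrictTotalOrder : IsStrictTotalOrder _≡_ _<_
    wellFounded        : WellFounded _<_

  _≤_ : Rel Carrier ℓ
  α ≤ β = α < β ⊎ α ≡ β

  ≤-trans : ∀ {α β δ} → α ≤ β → β ≤ δ → α ≤ δ
  ≤-trans (inj₁ p) (inj₁ q) = inj₁ (IsStrictTotalOrder.trans isStrictTotalOrder p q)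
  ≤-trans (inj₁ p) (inj₂ refl) = inj₁ p
  ≤-trans (inj₂ refl) q = q

  <-≤-trans : ∀ {α β δ} → α < β → β ≤ δ → α < δ
  <-≤-trans p (inj₁ q) = IsStrictTotalOrder.trans isStrictTotalOrder p q
  <-≤-trans p (inj₂ refl) = p

-- The annotated system P^γ enters through its diagram only.  That diagram need
-- not be a polynomial: for i₁ → i in ar(r), a formula of prem (r , i₁) which
-- is not a restriction of one of prem (r , i) can be the target of a step, and
-- then arrows into (prem (r , i) , g) may have no lift satisfying Bounded.

module Annotation {ℓ : Level} (ext : Extensionality ℓ ℓ) {Jdg : Category ℓ}
                  {P : ProofSystem Jdg} (t : TraceStructure P) (γ : Ordinal ℓ)
                  where
  open ProofSystem P
  open TraceStructure t
  private
    module Jdg = Category Jdg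
    module R = Category R
    module A {r} = Category (premises r)
    module γ = Ordinal γ
    module fml = Presheaf fml
    module ar = CatFunctor ar

  Ann : Obj Jdg → Set ℓ
  Ann s = Ob fml s → γ.Carrier

  Monotone : ∀ {s₁ s₂} → Hom Jdg s₁ s₂ → Ann s₁ → Ann s₂ → Set ℓ
  Monotone h f₁ f₂ = ∀ φ → f₁ (act fml h φ) γ.≤ f₂ φ

  Mono-id : ∀ {s} {h : Hom Jdg s s} (f : Ann s) → h ≡ Jdg.id → Monotone h f f
  Mono-id f refl φ = inj₂ (cong f (fml.identity φ))

  Mono-∘ : ∀ {s₁ s₂ s₃} {g : Hom Jdg s₂ s₃} {f : Hom Jdg s₁ s₂} {h : Hom Jdg s₁ s₃}
             a₁ {a₂ a₃} → h ≡ g Jdg.∘ f →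
           Monotone g a₂ a₃ → Monotone f a₁ a₂ → Monotone h a₁ a₃
  Mono-∘ {g = g} {f} a₁ refl q p φ = γ.≤-trans
    (inj₂ (cong a₁ (fml.homomorphism g f φ))) (γ.≤-trans (p (act fml g φ)) (q φ))

  record JdgHom (x y : Σ (Obj Jdg) Ann) : Set ℓ where
    constructor _,_
    field
      arr      : Hom Jdg (proj₁ x) (proj₁ y)
      monotone : Irrelevant (Monotone arr (proj₂ x) (proj₂ y))

  JdgHom≡ : ∀ {x y} {f g : JdgHom x y} → JdgHom.arr f ≡ JdgHom.arr g → f ≡ g
  JdgHom≡ {f = f , [ _ ]} {.f , [ _ ]} refl = refl

  Jdgᵞ : Category ℓ
  Jdgᵞ = record
    { Obj       = Σ (Obj Jdg) Ann
    ; Hom       = JdgHom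
    ; id        = Jdg.id , [ Mono-id _ refl ]
    ; _∘_       = λ { {x = _ , a} (g , [ q ]) (f , [ p ]) →
                      g Jdg.∘ f , [ Mono-∘ {g = g} {f} a refl q p ] }
    ; identityˡ = λ f → JdgHom≡ (Jdg.identityˡ _)
    ; identityʳ = λ f → JdgHom≡ (Jdg.identityʳ _)
    ; assoc     = λ h g f → JdgHom≡ (Jdg.assoc _ _ _)
    }

  record RHom (x y : Σ[ r ∈ Obj R ] Ann (F₀ ccl r)) : Set ℓ where
    constructor _,_
    field
      arr      : Hom R (proj₁ x) (proj₁ y)
      monotone : Irrelevant (Monotone (F₁ ccl arr) (proj₂ x) (proj₂ y))

  RHom≡ : ∀ {x y} {f g : RHom x y} → RHom.arr f ≡ RHom.arr g → f ≡ g
  RHom≡ {f = f , [ _ ]} {.f , [ _ ]} refl = refl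

  Rᵞ : Category ℓ
  Rᵞ = record
    { Obj       = Σ[ r ∈ Obj R ] Ann (F₀ ccl r)
    ; Hom       = RHom
    ; id        = R.id , [ Mono-id _ (Functor.identity ccl) ]
    ; _∘_       = λ { {x = _ , a} (g , [ q ]) (f , [ p ]) →
                      g R.∘ f , [ Mono-∘ a (Functor.homomorphism ccl g f) q p ] }
    ; identityˡ = λ f → RHom≡ (R.identityˡ _)
    ; identityʳ = λ f → RHom≡ (R.identityʳ _)
    ; assoc     = λ h g f → RHom≡ (R.assoc _ _ _)
    }

  Bounded : ∀ r → Ann (F₀ ccl r) → (i : Obj (premises r)) → Ann (F₀ prem (r , i)) → Set ℓ
  Bounded r f i g = ∀ φ ψ →
    let φ′ = (F₀ ccl r , φ)
        ψ′ = (F₀ prem (r , i) , ψ)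
    in (φ′ ⇝[ r , i ] ψ′ → g ψ γ.≤ f φ) × (Prog φ′ (r , i) ψ′ → g ψ γ.< f φ)

  record ArOb (x : Obj Rᵞ) : Set ℓ where
    constructor annotated
    field
      label   : Σ[ i ∈ Obj (premises (proj₁ x)) ] Ann (F₀ prem (proj₁ x , i))
      bounded : Irrelevant (Bounded (proj₁ x) (proj₂ x) (proj₁ label) (proj₂ label))

    premise : Obj (premises (proj₁ x))
    premise = proj₁ label

    ann : Ann (F₀ prem (proj₁ x , premise))
    ann = proj₂ label

  open ArOb

  ArOb≡ : ∀ {x} {i j : ArOb x} → label i ≡ label j → i ≡ j
  ArOb≡ {i = annotated l [ _ ]} {annotated .l [ _ ]} refl = refl

  record ArHom {x : Obj Rᵞ} (i j : ArOb x) : Set ℓ where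
    constructor _,_
    field
      arr      : Hom (premises (proj₁ x)) (premise i) (premise j)
      monotone : Irrelevant (Monotone (F₁ prem (incl arr)) (ann i) (ann j))

  ArHom≡ : ∀ {x} {i j : ArOb x} {f g : ArHom i j} → ArHom.arr f ≡ ArHom.arr g → f ≡ g
  ArHom≡ {f = f , [ _ ]} {.f , [ _ ]} refl = refl

  arᵞ₀ : Obj Rᵞ → Category ℓ
  arᵞ₀ x = record
    { Obj       = ArOb x
    ; Hom       = ArHom
    ; id        = A.id , [ Mono-id _ (trans (cong (F₁ prem) incl-id) (Functor.identity prem)) ]
    ; _∘_       = λ { {x = i} (g , [ q ]) (f , [ p ]) →
        g A.∘ f , [ Mono-∘ (ann i) (trans (cong (F₁ prem) (incl-∘ g f))
                                     (Functor.homomorphism prem (incl g) (incl f))) q p ] }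
    ; identityˡ = λ f → ArHom≡ (A.identityˡ _)
    ; identityʳ = λ f → ArHom≡ (A.identityʳ _)
    ; assoc     = λ h g f → ArHom≡ (A.assoc _ _ _)
    }

  -- By prem-cart, act fml (F₁ prem k) is for k = cart h i the transport along
  -- prem (r₁ , i) ≡ prem (r₂ , ar h i), so that pull g (cart h i) is the pair
  -- (ar(h)(i) , g).
  pull : ∀ {x r i} → Ann (F₀ prem x) → ∫Hom x (r , i) →
         Σ[ i ∈ Obj (premises r) ] Ann (F₀ prem (r , i))
  pull {i = i} g k = i , λ ψ → g (act fml (F₁ prem k) ψ)

  pull-cong : ∀ {x r i j} (g : Ann (F₀ prem x))
                {k : ∫Hom x (r , i)} {k′ : ∫Hom x (r , j)} →
              ∫ᶜ [ k ≋ k′ ] → pull g k ≡ pull g k′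
  pull-cong g refl = refl

  pull-id : ∀ {r i} (g : Ann (F₀ prem (r , i))) → pull g (∫id {r , i}) ≡ (i , g)
  pull-id {i = i} g = cong (i ,_) (ext λ ψ → cong g
    (trans (cong (λ e → act fml e ψ) (Functor.identity prem)) (fml.identity ψ)))

  pull-∘ : ∀ {x y r i} (g : Ann (F₀ prem x)) (k′ : ∫Hom y (r , i)) (k : ∫Hom x y) →
           pull g (k′ ∙ k) ≡ pull (proj₂ (pull g k)) k′
  pull-∘ {i = i} g k′ k = cong (i ,_) (ext λ ψ → cong g
    (trans (cong (λ e → act fml e ψ) (Functor.homomorphism prem k′ k))
           (fml.homomorphism _ _ ψ)))

  arᵞ₁ : ∀ {x y} → RHom x y → Functor (arᵞ₀ x) (arᵞ₀ y)
  arᵞ₁ {r₁ , f₁} {r₂ , f₂} (h , [ mono ]) = record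
    { F₀           = λ { (annotated (i , g) [ b ]) → annotated (pull g (cart h i))
        [ (λ φ ψ →
            (λ st → γ.≤-trans (proj₁ (b _ _) (⇝-pull h i st)) (mono φ)) ,
            (λ pr → γ.<-≤-trans (proj₂ (b _ _) (Prog-pull h i pr)) (mono φ))) ] }
    ; F₁           = λ { {i} {j} (k , [ p ]) →
        F₁ (ar₁ h) k , [ (λ φ → γ.≤-trans (inj₂ (cong (ann i) (square k φ)))
                                          (p (act fml (F₁ prem (cart h (premise j))) φ))) ] }
    ; identity     = ArHom≡ (Functor.identity (ar₁ h))
    ; homomorphism = λ _ _ → ArHom≡ (Functor.homomorphism (ar₁ h) _ _)
    }
    where
    square : ∀ {i j} (k : Hom (premises r₁) i j) φ →
             act fml (F₁ prem (cart h i)) (act fml (F₁ prem (incl (F₁ (ar₁ h) k))) φ)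
             ≡ act fml (F₁ prem (incl k)) (act fml (F₁ prem (cart h j)) φ)
    square {i} {j} k φ =
      trans (sym (fml.homomorphism _ _ φ))
      (trans (cong (λ e → act fml e φ)
        (trans (sym (Functor.homomorphism prem (incl (F₁ (ar₁ h) k)) (cart h i)))
        (trans (cong (F₁ prem) (sym (cart-natural h k)))
               (Functor.homomorphism prem (cart h j) (incl k)))))
        (fml.homomorphism _ _ φ))

  ArHom-≋ : ∀ {x} {i j i′ j′ : ArOb x} {f : ArHom i j} {g : ArHom i′ j′} →
            i ≡ i′ → j ≡ j′ →
            premises (proj₁ x) [ ArHom.arr f ≋ ArHom.arr g ] → arᵞ₀ x [ f ≋ g ]
  ArHom-≋ refl refl e = ≡⇒≋ (ArHom≡ (≋⇒≡ e))

  arᵞ : CatFunctor Rᵞ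
  arᵞ = record
    { fibre        = arᵞ₀
    ; map          = arᵞ₁
    ; identity     = record
      { objects = id-Obj
      ; arrows  = λ { {i} {j} k → ArHom-≋ (id-Obj i) (id-Obj j)
                        (arrows ar.identity (ArHom.arr k)) } }
    ; homomorphism = λ g f → record
      { objects = ∘-Obj g f
      ; arrows  = λ { {i} {j} k → ArHom-≋ (∘-Obj g f i) (∘-Obj g f j)
          (arrows (ar.homomorphism (RHom.arr g) (RHom.arr f)) (ArHom.arr k)) } }
    }
    where
    id-Obj : ∀ {x} (i : ArOb x) → F₀ (arᵞ₁ (Category.id Rᵞ)) i ≡ i
    id-Obj i = ArOb≡ (trans (pull-cong (ann i) (cart-id (premise i))) (pull-id (ann i)))

    ∘-Obj : ∀ {x y z} (g : RHom y z) (f : RHom x y) (i : ArOb x) →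
            F₀ (arᵞ₁ (Category._∘_ Rᵞ g f)) i ≡ F₀ (arᵞ₁ g) (F₀ (arᵞ₁ f) i)
    ∘-Obj (h′ , _) (h , _) i =
      ArOb≡ (trans (pull-cong (ann i) (cart-∘ h′ h (premise i)))
                   (pull-∘ (ann i) (cart h′ _) (cart h (premise i))))

  module Gᵞ = Grothendieck arᵞ

  forget : ∀ x → Functor (arᵞ₀ x) (premises (proj₁ x))
  forget x = record
    { F₀ = premise ; F₁ = ArHom.arr ; identity = refl ; homomorphism = λ _ _ → refl }

  u₁ᵞ : Functor Gᵞ.∫ᶜ ∫ᶜ
  u₁ᵞ = record
    { F₀           = λ { (x , i) → proj₁ x , premise i }
    ; F₁           = λ f → RHom.arr (Gᵞ.base f) , ArHom.arr (Gᵞ.vert f)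
    ; identity     = λ { {x , i} → ∫Hom≡ refl (≡⇒≋
        (F₁-coe (forget x) (objects (CatFunctor.identity arᵞ) i)
          (objects ar.identity (premise i)))) }
    ; homomorphism = λ { {_ , i} {z = z , _} g f → ∫Hom≡ refl (≡⇒≋ (cong
        (λ c → ArHom.arr (Gᵞ.vert g) A.∘
               (F₁ (ar₁ (RHom.arr (Gᵞ.base g))) (ArHom.arr (Gᵞ.vert f)) A.∘ c))
        (F₁-coe (forget z)
          (objects (CatFunctor.homomorphism arᵞ (Gᵞ.base g) (Gᵞ.base f)) i)
          (objects (ar.homomorphism (RHom.arr (Gᵞ.base g)) (RHom.arr (Gᵞ.base f)))
                   (premise i))))) }
    }

  premᵞ : Functor Gᵞ.∫ᶜ Jdgᵞ
  premᵞ = record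
    { F₀           = λ { ((r , f) , i) → F₀ prem (r , premise i) , ann i }
    ; F₁           = λ { f → F₁ prem (F₁ u₁ᵞ f) , premᵞ-mono f }
    ; identity     = JdgHom≡ (trans (cong (F₁ prem) (Functor.identity u₁ᵞ))
                                    (Functor.identity prem))
    ; homomorphism = λ g f → JdgHom≡
        (trans (cong (F₁ prem) (Functor.homomorphism u₁ᵞ g f))
               (Functor.homomorphism prem (F₁ u₁ᵞ g) (F₁ u₁ᵞ f)))
    }
    where
    premᵞ-mono : ∀ {x y} (f : Gᵞ.∫Hom x y) →
                 Irrelevant (Monotone (F₁ prem (F₁ u₁ᵞ f)) (ann (proj₂ x)) (ann (proj₂ y)))
    premᵞ-mono {_ , i} f@(h , (k , [ p ])) = [ (λ φ → γ.≤-trans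
      (inj₂ (cong (ann i) (trans
        (cong (λ e → act fml e φ)
          (trans (cong (F₁ prem) (sym (incl-cart (F₁ u₁ᵞ f))))
                 (Functor.homomorphism prem (incl k) (cart (RHom.arr h) (premise i)))))
        (fml.homomorphism _ _ φ))))
      (p φ)) ]

  cclᵞ : Functor Rᵞ Jdgᵞ
  cclᵞ = record
    { F₀           = λ { (r , f) → F₀ ccl r , f }
    ; F₁           = λ { (h , m) → F₁ ccl h , m }
    ; identity     = JdgHom≡ (Functor.identity ccl)
    ; homomorphism = λ g f → JdgHom≡ (Functor.homomorphism ccl _ _)
    }

  JdgHom-≋ : ∀ {x y x′ y′} {f : JdgHom x y} {g : JdgHom x′ y′} →
             x ≡ x′ → y ≡ y′ → Jdg [ JdgHom.arr f ≋ JdgHom.arr g ] → Jdgᵞ [ f ≋ g ]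
  JdgHom-≋ refl refl e = ≡⇒≋ (JdgHom≡ (≋⇒≡ e))

  RHom-≋ : ∀ {x y x′ y′} {f : RHom x y} {g : RHom x′ y′} →
           x ≡ x′ → y ≡ y′ → R [ RHom.arr f ≋ RHom.arr g ] → Rᵞ [ f ≋ g ]
  RHom-≋ refl refl e = ≡⇒≋ (RHom≡ (≋⇒≡ e))

  uᵞ : Functor Jdgᵞ Jdg
  uᵞ = record
    { F₀ = proj₁ ; F₁ = JdgHom.arr ; identity = refl ; homomorphism = λ _ _ → refl }

  u₂ᵞ : Functor Rᵞ R
  u₂ᵞ = record
    { F₀ = proj₁ ; F₁ = RHom.arr ; identity = refl ; homomorphism = λ _ _ → refl }

  Ann-subst : ∀ {s s′} {f : Ann s} {f′ : Ann s′} →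
              _≡_ {A = Σ (Obj Jdg) Ann} (s , f) (s′ , f′) → (p : s′ ≡ s) →
              f ≡ subst Ann p f′
  Ann-subst refl refl = refl

  Ann-lift : ∀ {s s′} (p : s ≡ s′) (f : Ann s) →
             _≡_ {A = Σ (Obj Jdg) Ann} (s′ , subst Ann p f) (s , f)
  Ann-lift refl f = refl

  Mono-≋ : ∀ {s₁ s₂ s₁′ s₂′} {g : Hom Jdg s₁ s₂} {h : Hom Jdg s₁′ s₂′} {a b} →
           Jdg [ g ≋ h ] → (p : s₁ ≡ s₁′) (q : s₂ ≡ s₂′) →
           Monotone g a b → Monotone h (subst Ann p a) (subst Ann q b)
  Mono-≋ refl refl refl m = m

  cclᵞ-fib : IsDiscreteFibration cclᵞ
  cclᵞ-fib = record
    { dom    = λ { (r , _) {_ , f′} (g , _) →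
                   fib.dom r g , subst Ann (≋-dom (≋-sym (fib.over r g))) f′ }
    ; lift   = λ { (r , _) (g , [ m ]) →
                   fib.lift r g ,
                   [ Mono-≋ (≋-sym (fib.over r g)) (≋-dom (≋-sym (fib.over r g))) refl m ] }
    ; over   = λ { (r , _) (g , _) →
                   JdgHom-≋ (Ann-lift (≋-dom (≋-sym (fib.over r g))) _) refl
                            (fib.over r g) }
    ; unique = λ { (r , _) (g , _) (k , _) e →
        let e′ = fib.unique r g k (F₁-cong uᵞ e)
        in RHom-≋ (dom≡ (≋-dom e′) (≋-dom e) (≋-dom (≋-sym (fib.over r g)))) refl e′ }
    }
    where
    module fib = IsDiscreteFibration ccl-fib
    dom≡ : ∀ {r r′ s} {f : Ann (F₀ ccl r)} {f′ : Ann s} → r ≡ r′ →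
           _≡_ {A = Σ (Obj Jdg) Ann} (F₀ ccl r , f) (s , f′) →
           (p : s ≡ F₀ ccl r′) →
           _≡_ {A = Obj Rᵞ} (r , f) (r′ , subst Ann p f′)
    dom≡ {r} refl e p = cong (r ,_) (Ann-subst e p)

  rulesᵞ : RuleSystem Jdgᵞ
  rulesᵞ = record
    { R = Rᵞ ; ar = arᵞ ; prem = premᵞ ; ccl = cclᵞ ; ccl-fib = cclᵞ-fib }

  diagramᵞ : Diagram Jdgᵞ
  diagramᵞ = RuleSystem.diagram rulesᵞ

  forgetᵞ : VPolyHom uᵞ diagramᵞ diagram
  forgetᵞ = record
    { u₁       = u₁ᵞ
    ; u₂       = u₂ᵞ
    ; s-square = record { objects = λ _ → refl ; arrows = λ _ → refl }
    ; q-square = record { objects = λ _ → refl ; arrows = λ _ → refl }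
    ; t-square = record
      { commutes  = record { objects = λ _ → refl ; arrows = λ _ → refl }
      ; universal = λ F G e → record
        { F₀           = λ x → F₀ G x , subst Ann (objects e x) (proj₂ (F₀ F x))
        ; F₁           = λ {x} {y} m → F₁ G m , univ-mono (F₁ F m) (arrows e m)
                                                  (objects e x) (objects e y)
        ; identity     = RHom≡ (Functor.identity G)
        ; homomorphism = λ g f → RHom≡ (Functor.homomorphism G g f)
        }
      ; fst-β     = λ F G e → record
        { objects = λ x → Ann-lift (objects e x) (proj₂ (F₀ F x))
        ; arrows  = λ {x} {y} m →
            JdgHom-≋ (Ann-lift (objects e x) _) (Ann-lift (objects e y) _)
                     (≋-sym (arrows e m))
        }
      ; snd-β     = λ F G e → record { objects = λ _ → refl ; arrows = λ _ → refl }
      ; unique    = λ F G e H p q →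
          let H≡ = λ x → univ-Obj (objects q x) (objects p x) (objects e x)
          in record { objects = H≡ ; arrows = λ {x} {y} m →
               RHom-≋ (H≡ x) (H≡ y) (arrows q m) }
      }
    }
    where
    univ-mono : ∀ {x y} {s s′} {h : Hom Jdg s s′} (f : JdgHom x y) →
                Jdg [ JdgHom.arr f ≋ h ] → (p : proj₁ x ≡ s) (q : proj₁ y ≡ s′) →
                Irrelevant (Monotone h (subst Ann p (proj₂ x)) (subst Ann q (proj₂ y)))
    univ-mono (_ , [ m ]) e p q = [ Mono-≋ e p q m ]

    univ-Obj : ∀ {r r′ : Obj R} {f : Ann (F₀ ccl r)} {x} → r ≡ r′ →
               _≡_ {A = Σ (Obj Jdg) Ann} (F₀ ccl r , f) x →
               (p : proj₁ x ≡ F₀ ccl r′) →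
               _≡_ {A = Obj Rᵞ} (r , f) (r′ , subst Ann p (proj₂ x))
    univ-Obj {r} refl e p = cong (r ,_) (Ann-subst e p)

{-# OPTIONS --safe #-}

-- For every polynomial, recursiveness of a coalgebra is well-foundedness of
-- its relation "is a component of".  So the theorem compares infinite paths of
-- c with infinite paths of c whose formulae carry descending annotations.
-- An infinitely progressing trace along an annotated path would give an
-- infinite descent in γ.  Conversely, if no suffix of a path carries an
-- infinitely progressing trace, then reachability through a progressing step is
-- well-founded on the formulae of the path, and its rank function annotates
-- the path.

module Submission where

open import Defs
open import Level using (Level; 0ℓ)
open import Axiom.ExcludedMiddle using (ExcludedMiddle)
open import Axiom.Extensionality.Propositional
  using (Extensionality; lower-extensionality)
open import Axiom.UniquenessOfIdentityProofs.WithK using (uip)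
open import Data.Bool.Base using (Bool; true)
open import Data.Irrelevant using ([_])
open import Data.Nat.Base as ℕ using (ℕ; zero; suc)
open import Data.Nat.Properties as ℕ using ()
open import Data.Product using (Σ; Σ-syntax; ∃; ∃-syntax; _×_; _,_; proj₁; proj₂)
open import Data.Sum.Base using (_⊎_; inj₁; inj₂)
open import Function.Bundles using (_⇔_; mk⇔)
open import Induction.InfiniteDescent using (InfiniteDescendingSequence; descent∧wf⇒empty)
open import Induction.WellFounded using (Acc; acc; WellFounded)
open import Relation.Binary.Core using (Rel)
open import Relation.Binary.Definitions using (tri<; tri≈; tri>)
open import Relation.Binary.PropositionalEquality
  using (_≡_; refl; sym; trans; cong; cong₂; subst; isEquivalence)
open import Relation.Nullary.Decidable
  using (Dec; yes; no; does; does-⇔; dec-true; recompute; decidable-stable)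
open import Relation.Nullary.Negation using (¬_; contradiction)

private
  variable
    ℓ : Level

true⇒ : {P : Set ℓ} (P? : Dec P) → does P? ≡ true → P
true⇒ (yes p) _ = p
true⇒ (no _) ()

-- Well-foundedness and infinite descent

module _ {A : Set ℓ} {_<_ : Rel A ℓ} where

  wellFounded⇒noDescent : WellFounded _<_ → (f : ℕ → A) →
                          ¬ InfiniteDescendingSequence _<_ f
  wellFounded⇒noDescent wf f desc =
    descent∧wf⇒empty {P = λ x → ∃[ k ] f k ≡ x}
      (λ { (k , refl) → f (suc k) , desc k , suc k , refl }) wf (f 0) (0 , refl)

  module _ (lem : ExcludedMiddle ℓ) where

    -- Excluded middle for arbitrary types yields an actual witness, so this can be iterated into a
    -- descending sequence.
    ¬acc⇒∃ : ∀ {x} → ¬ Acc _<_ x → ∃[ y ] y < x × ¬ Acc _<_ y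
    ¬acc⇒∃ ¬a = decidable-stable lem λ none →
      ¬a (acc λ {y} y<x → decidable-stable lem λ ¬b → none (y , y<x , ¬b))

    noDescent⇒wellFounded : (∀ f → ¬ InfiniteDescendingSequence _<_ f) →
                            WellFounded _<_
    noDescent⇒wellFounded none x = decidable-stable lem λ ¬a →
      none (λ k → proj₁ (seq ¬a k)) (λ k → proj₁ (proj₂ (¬acc⇒∃ (proj₂ (seq ¬a k)))))
      where
      seq : ¬ Acc _<_ x → ℕ → ∃[ y ] ¬ Acc _<_ y
      seq ¬a zero    = x , ¬a
      seq ¬a (suc k) =
        let y , _ , ¬b = ¬acc⇒∃ (proj₂ (seq ¬a k)) in y , ¬b

-- Ranks of a well-founded relation

module Rank (lem : ExcludedMiddle ℓ) (ext : Extensionality ℓ ℓ)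
            {X : Set ℓ} {_≺_ : Rel X ℓ} (wf : WellFounded _≺_) where

  infix 4 _⊑_ _⊏_ _≈_

  -- x ⊑ y says that the rank of x is at most that of y.
  data _⊑_ : Rel X ℓ where
    below : ∀ {x y} → (∀ {x′} → x′ ≺ x → ∃[ y′ ] y′ ≺ y × x′ ⊑ y′) → x ⊑ y

  _⊏_ : Rel X ℓ
  x ⊏ y = ∃[ y′ ] y′ ≺ y × x ⊑ y′

  _≈_ : Rel X ℓ
  x ≈ y = x ⊑ y × y ⊑ x

  ⊑-refl : ∀ {x} → x ⊑ x
  ⊑-refl {x} = go (wf x)
    where
    go : ∀ {x} → Acc _≺_ x → x ⊑ x
    go (acc rs) = below λ p → _ , p , go (rs p)

  ⊑-trans : ∀ {x y z} → x ⊑ y → y ⊑ z → x ⊑ z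
  ⊑-trans (below f) (below g) = below λ p →
    let _ , p′ , l  = f p
        _ , p″ , l′ = g p′
    in _ , p″ , ⊑-trans l l′

  ⊑-⊏-trans : ∀ {x y z} → x ⊑ y → y ⊏ z → x ⊏ z
  ⊑-⊏-trans l (_ , p , l′) = _ , p , ⊑-trans l l′

  ⊏-⊑-trans : ∀ {x y z} → x ⊏ y → y ⊑ z → x ⊏ z
  ⊏-⊑-trans (_ , p , l) (below g) = let _ , p′ , l′ = g p in _ , p′ , ⊑-trans l l′

  ≺⇒⊏ : ∀ {x y} → x ≺ y → x ⊏ y
  ≺⇒⊏ p = _ , p , ⊑-refl

  ⊏⇒⊑ : ∀ {x y} → x ⊏ y → x ⊑ y
  ⊏⇒⊑ {y = y} = go (wf y)
    where
    go : ∀ {x y} → Acc _≺_ y → x ⊏ y → x ⊑ y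
    -- The predecessors of `x` are strictly below `y′`, hence by induction weakly below it, so `y′`
    -- itself serves as the bound.
    go (acc rs) (y′ , p , below f) = below λ q → y′ , p , go (rs p) (f q)

  ⊏-irrefl : ∀ {x} → ¬ x ⊏ x
  ⊏-irrefl {x} = go (wf x)
    where
    go : ∀ {x} → Acc _≺_ x → ¬ x ⊏ x
    go (acc rs) (x′ , p , below f) = go (rs p) (f p)

  ⊏-wellFounded : WellFounded _⊏_
  ⊏-wellFounded x = go (wf x) ⊑-refl
    where
    go : ∀ {x y} → Acc _≺_ y → x ⊑ y → Acc _⊏_ x
    go (acc rs) l = acc λ p →
      let _ , q , l′ = ⊏-⊑-trans p l in go (rs q) l′

  ⊑-or-⊐ : ∀ x y → x ⊑ y ⊎ y ⊏ x
  ⊑-or-⊐ x = go (wf x)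
    where
    go : ∀ {x} → Acc _≺_ x → ∀ y → x ⊑ y ⊎ y ⊏ x
    -- A predecessor `x′` of `x` that is not below `y` witnesses `y ⊏ x`: each `y′ ≺ y` is below
    -- `x′`, since `x′ ⊑ y′` would give `x′ ⊏ y`.
    go {x} (acc rs) y with lem {∃[ x′ ] x′ ≺ x × ¬ x′ ⊏ y}
    ... | no none = inj₁ (below λ p → decidable-stable lem λ ¬q → none (_ , p , ¬q))
    ... | yes (x′ , p , ¬q) = inj₂ (x′ , p , below λ {y′} r → case (go (rs p) y′) r)
      where
      case : ∀ {y′} → x′ ⊑ y′ ⊎ y′ ⊏ x′ → y′ ≺ y → y′ ⊏ x′
      case (inj₁ l) r = contradiction (_ , r , l) ¬q
      case (inj₂ l) r = l

  -- Boolean values let function extensionality turn equivalent elements into equal classes.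
  class : X → X → Bool
  class x y = does (lem {x ≈ y})

  class-cong : ∀ {x y} → x ≈ y → class x ≡ class y
  class-cong (l , l′) = lower-extensionality 0ℓ _ ext λ z → does-⇔
    (mk⇔ (λ { (m , m′) → ⊑-trans l′ m , ⊑-trans m′ l })
         (λ { (m , m′) → ⊑-trans l m , ⊑-trans m′ l′ })) lem lem

  -- The irrelevant argument makes the witness depend on `f` alone.
  choose : (f : X → Bool) → .(∃[ x ] f x ≡ true) → ∃[ x ] f x ≡ true
  choose f e = recompute lem e

  -- Equivalent elements have equal characteristic functions, from which excluded
  -- middle, being stated for arbitrary types, chooses the same element.
  rep : X → X
  rep x = proj₁ (choose (class x) (x , dec-true lem (⊑-refl , ⊑-refl)))

  rep-≈ : ∀ x → x ≈ rep x
  rep-≈ x = true⇒ lem (proj₂ (choose (class x) (x , dec-true lem (⊑-refl , ⊑-refl))))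

  rep-cong : ∀ {x y} → x ≈ y → rep x ≡ rep y
  rep-cong {x} {y} e = go (class-cong e)
    where
    go : ∀ {f g} .{p : ∃[ z ] f z ≡ true} .{q : ∃[ z ] g z ≡ true} → f ≡ g →
         proj₁ (choose f p) ≡ proj₁ (choose g q)
    go refl = refl

  -- The quotient of `X` by `_≈_`, presented by canonical representatives.
  Ranks : Set ℓ
  Ranks = Σ[ x ∈ X ] rep x ≡ x

  Ranks≡ : {α β : Ranks} → proj₁ α ≡ proj₁ β → α ≡ β
  Ranks≡ {x , p} {.x , q} refl = cong (x ,_) (uip p q)

  ⊑-antisym : {α β : Ranks} → proj₁ α ⊑ proj₁ β → proj₁ β ⊑ proj₁ α → α ≡ β
  ⊑-antisym {x , p} {y , q} l l′ = Ranks≡ (trans (sym p) (trans (rep-cong (l , l′)) q))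

  ordinal : Ordinal ℓ
  ordinal = record
    { Carrier            = Ranks
    ; _<_                = λ α β → proj₁ α ⊏ proj₁ β
    ; isStrictTotalOrder = record
      { isStrictPartialOrder = record
        { isEquivalence = isEquivalence
        ; irrefl        = λ { refl → ⊏-irrefl }
        ; trans         = λ p q → ⊏-⊑-trans p (⊏⇒⊑ q)
        ; <-resp-≈      = (λ { refl p → p }) , (λ { refl p → p })
        }
      ; compare = compare
      }
    ; wellFounded        = λ α → acc-Ranks (⊏-wellFounded (proj₁ α))
    }
    where
    compare : ∀ α β → _
    compare (x , p) (y , q) with ⊑-or-⊐ x y | ⊑-or-⊐ y x
    ... | inj₂ l | _      = tri> (λ l′ → ⊏-irrefl (⊏-⊑-trans l (⊏⇒⊑ l′)))
                                 (λ { refl → ⊏-irrefl l }) l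
    ... | inj₁ _ | inj₂ l = tri< l (λ { refl → ⊏-irrefl l })
                                 (λ l′ → ⊏-irrefl (⊏-⊑-trans l (⊏⇒⊑ l′)))
    ... | inj₁ l | inj₁ l′ = tri≈ (λ m → ⊏-irrefl (⊏-⊑-trans m l′)) (⊑-antisym l l′)
                                  (λ m → ⊏-irrefl (⊏-⊑-trans m l))

    acc-Ranks : ∀ {α : Ranks} → Acc _⊏_ (proj₁ α) →
                Acc (λ α β → proj₁ α ⊏ proj₁ β) α
    acc-Ranks (acc rs) = acc λ p → acc-Ranks (rs p)

  rank : X → Ordinal.Carrier ordinal
  rank x = rep x , rep-cong (let l , l′ = rep-≈ x in l′ , l)

  rank-≺ : ∀ {x y} → x ≺ y → Ordinal._<_ ordinal (rank x) (rank y)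
  rank-≺ {x} {y} p =
    ⊏-⊑-trans (⊑-⊏-trans (proj₂ (rep-≈ x)) (≺⇒⊏ p)) (proj₁ (rep-≈ y))

  rank-mono : ∀ {x y} → (∀ {z} → z ≺ x → z ≺ y) →
              Ordinal._≤_ ordinal (rank x) (rank y)
  rank-mono {x} {y} f with ⊑-or-⊐ (rep y) (rep x)
  ... | inj₂ l = inj₁ l
  ... | inj₁ l = inj₂ (⊑-antisym
    (⊑-trans (proj₂ (rep-≈ x)) (⊑-trans (below λ p → _ , f p , ⊑-refl) (proj₁ (rep-≈ y)))) l)

-- Non-increasing sequences in an ordinal

module _ (γ : Ordinal ℓ) where
  open Ordinal γ

  antitone : {α : ℕ → Carrier} → (∀ k → α (suc k) ≤ α k) →
             ∀ {m k} → m ℕ.≤′ k → α k ≤ α m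
  antitone dec ℕ.≤′-refl     = inj₂ refl
  antitone dec (ℕ.≤′-step l) = ≤-trans (dec _) (antitone dec l)

  antitone⇒eventuallyConstant : {α : ℕ → Carrier} → (∀ k → α (suc k) ≤ α k) →
                                ¬ (∀ m → ∃[ k ] m ℕ.≤ k × α (suc k) < α k)
  antitone⇒eventuallyConstant {α} dec drop =
    -- The values of `α` would form a nonempty set without a minimal element.
    descent∧wf⇒empty {_<_ = _<_} {P = λ β → ∃[ k ] α k ≡ β}
      (λ { (m , refl) → let k , m≤k , d = drop m in
           α (suc k) , <-≤-trans d (antitone dec (ℕ.≤⇒≤′ m≤k)) , suc k , refl })
      wellFounded (α 0) (0 , refl)

-- Recursive coalgebras

module WithClassicalLogic (lem : ExcludedMiddle ℓ) (ext : Extensionality ℓ ℓ) where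
  open Familial ext

  module _ {A : Category ℓ} {D : Diagram A} (c : Coalgebra D) where
    open Diagram D
    open Coalgebra c
    private
      module A = Category A
      module J = Category J
      module X = Presheaf carrier

    Element : Set ℓ
    Element = Σ (Obj A) (Ob carrier)

    infix 4 _◁_
    -- Families in `RanOb` are indexed by all arrows `m`, not only by the fibre of `q` over the
    -- index, and so are the components.
    data _◁_ : Rel Element ℓ where
      component : ∀ {x} (n : Ob carrier x) i (m : Hom J (F₀ q i) (index (η structure n))) →
                  (F₀ s i , at (val (η structure n)) i m) ◁ (x , n)

    module _ {X : Presheaf A} (a : F[ D ] X ⇒ X) where

      -- A solution at n presupposes a natural family of solutions at the
      -- components of n.  Defining its graph first decouples the two: that the
      -- graph is functional and closed under restriction needs no recursion on n.
      data Graph : ∀ {x} → Ob carrier x → Ob X x → Set ℓ where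
        graph : ∀ {x j} {p : F₀ t j ≡ x} {v} {n : Ob carrier x} →
                η structure n ≡ summand j p v → (w : RanOb q (s ^* X) j) →
                (∀ i m → Graph (at v i m) (at w i m)) →
                Graph n (η a (summand j p w))

      graph-functional : ∀ {x} {n : Ob carrier x} {y z} → Graph n y → Graph n z → y ≡ z
      graph-functional (graph e w g) (graph e′ w′ g′) = go (trans (sym e) e′) g g′
        where
        go : ∀ {x j j′} {p : F₀ t j ≡ x} {p′ : F₀ t j′ ≡ x}
               {v : RanOb q (s ^* carrier) j} {v′ w w′} →
             summand {fib = t-fib} {H = Ran q (s ^* carrier)} j p v ≡ summand j′ p′ v′ →
             (∀ i m → Graph (at v i m) (at w i m)) →
             (∀ i m → Graph (at v′ i m) (at w′ i m)) →
             η a (summand j p w) ≡ η a (summand j′ p′ w′)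
        go {p = p} refl g g′ = cong (λ u → η a (summand _ p u))
          (family≡ q λ i m → graph-functional (g i m) (g′ i m))

      -- The family at the restriction is a reindexing of the family at `n`, so the given graphs are
      -- reused.
      graph-act : ∀ {x y} (f : Hom A y x) {n z} → Graph n z →
                  Graph (act carrier f n) (act X f z)
      graph-act f {n} (graph {p = refl} {v} e w g) =
        subst (Graph _) (_⇒_.natural a f _)
          (graph (trans (_⇒_.natural structure f n) (cong (Lan-act t-fib _ f) e))
                 _ λ i m → g i _)

      wellFounded⇒graph : ∀ {x} (n : Ob carrier x) → Acc _◁_ (x , n) → ∃ (Graph n)
      wellFounded⇒graph n (acc rs) = _ , graph refl w λ i m → proj₂ (val′ i m)
        where
        v = val (η structure n)
        val′ : ∀ i m → ∃ (Graph (at v i m))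
        val′ i m = wellFounded⇒graph (at v i m) (rs (component n i m))
        w : RanOb q (s ^* X) (index (η structure n))
        w = record
          { at      = λ i m → proj₁ (val′ i m)
          -- Both sides are graph values at one element: one found by recursion, the other by
          -- restricting a recursive value.
          ; natural = λ f m → graph-functional
              (subst (λ k → Graph k (proj₁ (val′ _ (m J.∘ F₁ q f))))
                     (RanOb.natural v f m) (proj₂ (val′ _ _)))
              (graph-act (F₁ s f) (proj₂ (val′ _ m)))
          }

    wellFounded⇒recursive : WellFounded _◁_ → IsRecursive c
    wellFounded⇒recursive wf X a =
      h , (λ n → graph-functional a (proj₂ (g n)) (graph refl _ λ i m → proj₂ (g _))) ,
      λ h′ solves n → graph-functional a (solution h′ solves n (wf _)) (proj₂ (g n))
      where
      g : ∀ {x} (n : Ob carrier x) → ∃ (Graph a n)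
      g n = wellFounded⇒graph a n (wf _)
      h : carrier ⇒ X
      h = record
        { η       = λ n → proj₁ (g n)
        ; natural = λ f n → graph-functional a (proj₂ (g _)) (graph-act a f (proj₂ (g n)))
        }
      -- Yields uniqueness, because the graph is functional.
      solution : (h′ : carrier ⇒ X) →
                 (∀ {x} (n : Ob carrier x) → η h′ n ≡ η a (η (F[ D ]₁ h′) (η structure n))) →
                 ∀ {x} (n : Ob carrier x) → Acc _◁_ (x , n) → Graph a n (η h′ n)
      solution h′ solves n (acc rs) = subst (Graph a n) (sym (solves n))
        (graph refl _ λ i m → solution h′ solves _ (rs (component n i m)))

    -- The cofree presheaf on Bool: morphisms into it are Boolean functions on
    -- elements.  The algebra below is conjunction, so that the solutions are the
    -- functions whose value at n is the conjunction of those at the components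
    -- of n; both the constant true and accessibility are such.
    Cofree : Presheaf A
    Cofree = record
      { Ob           = λ x → ∀ y → Hom A y x → Bool
      ; act          = λ f S y g → S y (f A.∘ g)
      ; identity     = λ S → cofree≡ λ y g → cong (S y) (A.identityˡ g)
      ; homomorphism = λ g f S → cofree≡ λ y k → cong (S y) (A.assoc g f k)
      }
      where
      cofree≡ : ∀ {x} {S S′ : ∀ y → Hom A y x → Bool} → (∀ y g → S y g ≡ S′ y g) → S ≡ S′
      cofree≡ e = ext λ y → lower-extensionality 0ℓ _ ext (e y)

    AllTrue : ∀ {x} → Ob (F[ D ] Cofree) x → Set ℓ
    AllTrue z = ∀ i m → at (val z) i m (F₀ s i) A.id ≡ true

    conjunction : F[ D ] Cofree ⇒ Cofree
    conjunction = record
      -- Restricting along `f` first reduces naturality to functoriality of `F[ D ] Cofree`.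
      { η       = λ z y f → does (lem {AllTrue (act (F[ D ] Cofree) f z)})
      ; natural = λ g z → ext λ y → lower-extensionality 0ℓ _ ext λ f →
          cong (λ z′ → does (lem {AllTrue z′}))
               (sym (Presheaf.homomorphism (F[ D ] Cofree) g f z))
      }

    module _ (φ : Element → Bool) where

      transpose : carrier ⇒ Cofree
      transpose = record
        { η       = λ n y f → φ (y , act carrier f n)
        ; natural = λ f n → ext λ y → lower-extensionality 0ℓ _ ext λ g →
            cong (λ k → φ (y , k)) (sym (X.homomorphism f g n))
        }

      transpose-solves :
        (∀ e → φ e ≡ does (lem {∀ e′ → e′ ◁ e → φ e′ ≡ true})) →
        ∀ {x} (n : Ob carrier x) →
        η transpose n ≡ η conjunction (η (F[ D ]₁ transpose) (η structure n))
      transpose-solves fix n = ext λ y → lower-extensionality 0ℓ _ ext λ f →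
        trans (fix (y , act carrier f n))
        (trans (does-⇔ (mk⇔
          (λ all i m → trans (cong (λ k → φ (F₀ s i , k)) (X.identity _))
                             (all _ (component _ i m)))
          (λ { all _ (component _ i m) →
               trans (cong (λ k → φ (F₀ s i , k)) (sym (X.identity _))) (all i m) }))
          lem lem)
        (cong (λ z → does (lem {AllTrue z}))
          (_⇒_.natural (F[ D ]₁ transpose ∘⇒ structure) f n)))

    -- Uniqueness identifies accessibility with the constant true; evaluation at `A.id` returns to
    -- the element itself.
    recursive⇒wellFounded : IsRecursive c → WellFounded _◁_
    recursive⇒wellFounded rec (x , n) = subst (λ k → Acc _◁_ (x , k)) (X.identity n)
      (true⇒ lem (trans (cong (λ S → S x A.id)
        (trans (unique (transpose accessible) (transpose-solves accessible λ e →
                 does-⇔ (mk⇔ (λ { (acc rs) e′ p → dec-true lem (rs p) })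
                             (λ all → acc λ p → true⇒ lem (all _ p))) lem lem) n)
               (sym (unique (transpose λ _ → true)
                 (transpose-solves (λ _ → true) λ e → sym (dec-true lem λ _ _ → refl)) n))))
        refl))
      where
      unique = proj₂ (proj₂ (rec Cofree conjunction))
      accessible : Element → Bool
      accessible e = does (lem {Acc _◁_ e})

  -- Annotated paths

  module _ {Jdg : Category ℓ} {P : ProofSystem Jdg} (t : TraceStructure P) (γ : Ordinal ℓ) where
    open ProofSystem P
    open TraceStructure t
    open Annotation ext t γ
    open ArOb
    private
      module Jdg = Category Jdg
      module R = Category R
      module γ = Ordinal γ

    -- The judgement of a node equals the conclusion of its rule only propositionally; leaving `s`
    -- and `s′` free avoids transports in `Bounded`.
    Descends : ∀ {s s′} → ∫ᵒ → Ann s → Ann s′ → Set ℓ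
    Descends {s} {s′} ri g g′ = ∀ φ ψ →
      ((s , φ) ⇝[ ri ] (s′ , ψ) → g′ ψ γ.≤ g φ) × (Prog (s , φ) ri (s′ , ψ) → g′ ψ γ.< g φ)

    descends⇒bounded : ∀ {r s i} (p : s ≡ F₀ ccl r) {g : Ann s} {g′ : Ann (F₀ prem (r , i))} →
                       Descends (r , i) g g′ → Bounded r (subst Ann p g) i g′
    descends⇒bounded refl d = d

    bounded⇒descends : ∀ {r s i} (p : s ≡ F₀ ccl r) {g : Ann s} {g′ : Ann (F₀ prem (r , i))} →
                       Bounded r (subst Ann p g) i g′ → Descends (r , i) g g′
    bounded⇒descends refl d = d

    ann-bounded : ∀ {x} (o : ArOb x) → Bounded (proj₁ x) (proj₂ x) (premise o) (ann o)
    ann-bounded (annotated _ [ b ]) = recompute lem b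

    module _ (c : PreProof ext P) where
      open Coalgebra c

      cᵞ : Coalgebra diagramᵞ
      cᵞ = Coalg forgetᵞ c

      Elementᵞ : Set ℓ
      Elementᵞ = Element cᵞ

      -- The arrow of indices in the components of τ, for a component at i and m,
      -- is m composed with identities.
      arr-id : ∀ {r r′} (m : Hom R r′ r) → R.id R.∘ (m R.∘ R.id) ≡ m
      arr-id m = trans (R.identityˡ _) (R.identityʳ m)

      descends⇒◁ : ∀ {s s′} {g : Ann s} {g′ : Ann s′} {n n′} i →
                   (s′ , n′) ≡ child ext {P = P} c (s , n) i →
                   Descends (rule ext {P = P} c (s , n) , i) g g′ →
                   _◁_ cᵞ ((s′ , g′) , n′) ((s , g) , n)
      descends⇒◁ {s} {g = g} {g′} {n} i refl d = subst (λ k → _◁_ cᵞ (_ , k) _)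
        (trans (Presheaf.identity carrier _)
               (cong (at (val (η structure n)) _) (arr-id R.id)))
        (component n (_ , annotated (i , g′) [ descends⇒bounded _ d ]) (Category.id Rᵞ))

      along-identity : ∀ {x y} (k : Hom Jdg x y) → Jdg [ k ≋ Jdg.id {x} ] →
                       ∀ (g : Ann x) n → _≡_ {A = Elementᵞ}
                       ((y , λ ψ → g (act fml k ψ)) , n) ((x , g) , act carrier k n)
      along-identity k refl g n = cong₂ (λ g n → (_ , g) , n)
        (ext λ ψ → cong g (Presheaf.identity fml ψ)) (sym (Presheaf.identity carrier n))

      -- A component at (r′ , i) and m is the child at ar(m)(i), since by
      -- naturality they differ by prem (cart m i), which is an identity.
      ◁⇒descends : ∀ {s} {g : Ann s} {n} {e : Elementᵞ} →
                   _◁_ cᵞ e ((s , g) , n) →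
                   let ((s′ , g′) , n′) = e in
                   ∃[ i ] (s′ , n′) ≡ child ext {P = P} c (s , n) i ×
                          Descends (rule ext {P = P} c (s , n) , i) g g′
      ◁⇒descends {s} {g} {n} (component n ((r′ , f′) , o) m) =
        premise o′ , subst Good eq
          (refl , bounded⇒descends _ (ann-bounded o′))
        where
        h = RHom.arr m
        v = val (η structure n)
        o′ = F₀ (arᵞ₁ m) o
        k = F₁ prem (cart h (premise o))
        Good : Elementᵞ → Set ℓ
        Good ((s′ , g′) , n′) = (s′ , n′) ≡ child ext {P = P} c (s , n) (premise o′) ×
                                Descends (rule ext {P = P} c (s , n) , premise o′) g g′
        eq : _≡_ {A = Elementᵞ} _ _
        eq = trans (along-identity k (prem-cart h (premise o)) (ann o) _)
          (cong (_ ,_) (trans (sym (RanOb.natural v (cart h (premise o)) R.id))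
            (trans (cong (at v _) (trans (R.identityˡ h) (sym (arr-id h))))
                   (sym (Presheaf.identity carrier _)))))

      -- Forgetting annotations turns a descending sequence into a path of `c`; the annotations read
      -- along its trace never increase, yet drop infinitely often.
      GTC⇒wellFounded : GTC ext c t → WellFounded (_◁_ cᵞ)
      GTC⇒wellFounded gtc = noDescent⇒wellFounded lem noDescent
        where
        noDescent : ∀ e → ¬ InfiniteDescendingSequence (_◁_ cᵞ) e
        noDescent e desc = antitone⇒eventuallyConstant γ
          (λ k → proj₁ (descends k) (step k))
          (λ m′ → let k , m′≤k , pr = progressing m′ in k , m′≤k , proj₂ (descends k) pr)
          where
          edges = λ k → ◁⇒descends (desc k)

          path : Path ext {P = P} c
          path = record
            { node  = λ k → let ((s , _) , n) = e k in s , n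
            ; label = λ k → proj₁ (edges k)
            ; edge  = λ k → proj₁ (proj₂ (edges k))
            }

          m           = proj₁ (gtc path)
          progressing = proj₂ (proj₂ (gtc path))
          open Trace (proj₁ (proj₂ (gtc path)))
          -- The trace runs along the suffix from `m`, hence the shift.
          descends    = λ k → proj₂ (proj₂ (edges (k ℕ.+ m))) (formula k) (formula (suc k))

  -- The ordinal annotation of a path without infinitely progressing traces

  module _ {Jdg : Category ℓ} {P : ProofSystem Jdg} (t : TraceStructure P)
           (c : PreProof ext P) (p : Path ext {P = P} c) where
    open ProofSystem P
    open TraceStructure t
    open Path p

    Position : Set ℓ
    Position = Σ[ k ∈ ℕ ] Ob fml (proj₁ (node k))

    formulaAt : Position → Obj (∫ fml)
    formulaAt (k , φ) = proj₁ (node k) , φ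

    ruleAt : ℕ → ∫ᵒ
    ruleAt k = rule ext {P = P} c (node k) , label k

    -- y ≺ x if some trace segment from x to y ends with a progressing step.
    infix 4 _≺_
    data _≺_ (y : Position) : Position → Set ℓ where
      progress : ∀ {k φ ψ} → y ≡ (suc k , ψ) →
                 Prog (formulaAt (k , φ)) (ruleAt k) (formulaAt (suc k , ψ)) → y ≺ (k , φ)
      follow   : ∀ {k φ ψ} →
                 formulaAt (k , φ) ⇝[ ruleAt k ] formulaAt (suc k , ψ) →
                 y ≺ (suc k , ψ) → y ≺ (k , φ)

    InfinitelyProgressingTrace : Set ℓ
    InfinitelyProgressingTrace =
      ∃[ m ] Σ[ θ ∈ Trace ext c t (suffix ext {P = P} c m p) ] Trace.InfinitelyProgressing θ

    -- A trace under construction carries the rest of a segment towards an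
    -- inaccessible position; at its end, inaccessibility provides another segment.
    record Pending (k : ℕ) : Set ℓ where
      constructor pending
      field
        formula : Ob fml (proj₁ (node k))
        target  : Position
        segment : target ≺ (k , formula)
        ¬acc    : ¬ Acc _≺_ target

    open Pending

    next : ∀ {k} → Pending k → Pending (suc k)
    next (pending φ y (progress refl pr) ¬a) =
      let z , z≺y , ¬b = ¬acc⇒∃ lem ¬a in pending _ z z≺y ¬b
    next (pending φ y (follow st seg) ¬a) = pending _ y seg ¬a

    next-step : ∀ {k} (S : Pending k) →
                formulaAt (k , formula S) ⇝[ ruleAt k ] formulaAt (suc k , formula (next S))
    next-step (pending φ y (progress refl pr) ¬a) = Prog⊆⇝ pr
    next-step (pending φ y (follow st seg) ¬a) = st

    pending⇒trace : ∀ {m} → Pending m → InfinitelyProgressingTrace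
    pending⇒trace {m} S₀ =
      m , record { formula = λ k → formula (S k) ; step = λ k → next-step (S k) } ,
      λ k → progresses k (segment (S k)) refl
      where
      S : ∀ k → Pending (k ℕ.+ m)
      S zero    = S₀
      S (suc k) = next (S k)

      -- By induction on the segment carried at `k`, which is finite and ends with a progressing
      -- step.
      progresses : ∀ k {φ y ¬a} (seg : y ≺ (k ℕ.+ m , φ)) → S k ≡ pending φ y seg ¬a →
                   ∃[ j ] k ℕ.≤ j × Prog (formulaAt (j ℕ.+ m , formula (S j))) (ruleAt (j ℕ.+ m))
                                         (formulaAt (suc j ℕ.+ m , formula (S (suc j))))
      progresses k (progress refl pr) e = k , ℕ.≤-refl , subst
        (λ S → Prog (formulaAt (k ℕ.+ m , formula S)) (ruleAt (k ℕ.+ m))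
                    (formulaAt (suc k ℕ.+ m , formula (next S)))) (sym e) pr
      progresses k (follow st seg) e =
        let j , k<j , pr = progresses (suc k) seg (cong next e) in j , ℕ.<⇒≤ k<j , pr

    noTrace⇒wellFounded : ¬ InfinitelyProgressingTrace → WellFounded _≺_
    noTrace⇒wellFounded none x = decidable-stable lem λ ¬a →
      let y , y≺x , ¬b = ¬acc⇒∃ lem ¬a in none (pending⇒trace (pending (proj₂ x) y y≺x ¬b))

    module _ (γ : Ordinal ℓ) (g : ∀ k → Annotation.Ann ext t γ (proj₁ (node k)))
             (d : ∀ k → Descends t γ (ruleAt k) (g k) (g (suc k))) where

      annotated-path : ℕ → Elementᵞ t γ c
      annotated-path k = (proj₁ (node k) , g k) , proj₂ (node k)

      annotated-path-descends :
        InfiniteDescendingSequence (_◁_ (cᵞ t γ c)) annotated-path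
      annotated-path-descends k = descends⇒◁ t γ c (label k) (edge k) (d k)

    wellFounded⇒trace :
      (∀ γ → WellFounded (_◁_ (cᵞ t γ c))) → InfinitelyProgressingTrace
    wellFounded⇒trace wf = decidable-stable lem λ none →
      let open Rank lem ext (noTrace⇒wellFounded none)
      in wellFounded⇒noDescent (wf ordinal) _
        -- Prefixing a step by `follow` puts everything below its target below its source, so ranks
        -- do not increase; a progressing step is itself a segment, so ranks drop.
        (annotated-path-descends ordinal (λ k φ → rank (k , φ)) λ k φ ψ →
          (λ st → rank-mono (follow st)) , (λ pr → rank-≺ (progress refl pr)))

-- The global trace condition and recursiveness

module Equivalence (lem : ExcludedMiddle ℓ) (ext : Extensionality ℓ ℓ) {Jdg : Category ℓ}
                   (P : ProofSystem Jdg) (t : TraceStructure P) (c : PreProof ext P) where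
  open WithClassicalLogic lem ext
  open Familial ext

  GTC⇒recursive : GTC ext {P = P} c t → ∀ γ → IsRecursive (cᵞ t γ c)
  GTC⇒recursive gtc γ = wellFounded⇒recursive (cᵞ t γ c) (GTC⇒wellFounded t γ c gtc)

  recursive⇒GTC : (∀ γ → IsRecursive (cᵞ t γ c)) → GTC ext {P = P} c t
  recursive⇒GTC rec p = wellFounded⇒trace t c p λ γ → recursive⇒wellFounded (cᵞ t γ c) (rec γ)

theorem4p17 : ∀ {ℓ : Level} (lem : ExcludedMiddle ℓ) (ext : Extensionality ℓ ℓ)
    {Jdg : Category ℓ} (P : ProofSystem Jdg) (t : TraceStructure P)
    (c : PreProof ext P) →
    GTC ext c t ⇔
    (∀ (γ : Ordinal ℓ) →
    Familial.IsRecursive ext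
    (Familial.Coalg ext (Annotation.forgetᵞ ext t γ) c))
theorem4p17 lem ext P t c = mk⇔ E.GTC⇒recursive E.recursive⇒GTC
  where
  module E = Equivalence lem ext P t c
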